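{- For every real $\varepsilon>0$, there exists a finite simple connected graph $G$ that is not resistance nonnegative (RN) and satisfies $\tau(G)>\frac32-\varepsilon$.
   Context: All graphs are finite, simple and connected. For a graph $G$ and $S\subseteq V(G)$, let $c(G-S)$ be the number of connected components of $G-S$. The toughness of a noncomplete graph $G$ is $\tau(G):=\min\{|S|/c(G-S): S\subseteq V(G),\ c(G-S)>1\}$; complete graphs have infinite toughness. Resistance curvature: let $G=(V,E)$ be a finite simple connected graph, $\mathcal T(G)$ its set of spanning trees, and $c=(c_e)_{e\in E}$ positive edge weights. The relative resistance of an edge $e$ is $$r_e(c):=\frac{\sum_{T\in\mathcal T(G),\, e\in T}\prod_{h\in T}c_h}{\sum_{T\in\mathcal T(G)}\prod_{h\in T}c_h}$$ (equivalently $c_e$ times the effective resistance between the ends of $e$), and the resistance curvature of a vertex $v$ is $p_v(c):=1-\frac12\sum_{e\ni v}r_e(c)$. $G$ is resistance nonnegative (RN) if there exist positive edge weights $c$ with $p_v(c)\ge 0$ for every $v\in V$. -}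

module Defs where

import Data.Bool.Properties as Bool
open import Data.Fin.Base as Fin using (Fin; zero; suc)
import Data.Fin.Properties as Fin
open import Data.Fin.Subset as Subset using (Subset; inside; outside; ∣_∣)
import Data.Fin.Subset.Properties as Subset
import Data.Integer.Base as ℤ
open import Data.List.Base using
  (List; []; _∷_; _∷ʳ_; _++_; map; foldr; filter; length; lookup; allFin;
   cartesianProduct; deduplicate)
open import Data.List.Membership.Propositional using (_∈_)
open import Data.List.Membership.Propositional.Properties using
  (∈-filter⁺; ∈-filter⁻; ∈-lookup; ∈-allFin; ∈-cartesianProduct⁺; ∈-map⁺;
   ∈-++⁺ˡ; ∈-++⁺ʳ)
open import Data.List.Relation.Unary.All as All using (All; []; _∷_)
open import Data.List.Relation.Unary.AllPairs using ([]; _∷_)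
open import Data.List.Relation.Unary.Any using (here; there; index)
open import Data.List.Relation.Unary.Any.Properties using (lookup-index)
open import Data.List.Relation.Unary.Linked using (Linked; [-]; _∷_; linked?)
open import Data.List.Relation.Unary.Unique.Propositional using (Unique)
open import Data.Maybe.Base as Maybe using ()
open import Data.Nat.Base as ℕ using (ℕ; zero; suc; z≤n; s≤s)
import Data.Nat.Induction as ℕ
import Data.Nat.Properties as ℕ
open import Data.Product.Base using
  (∃; ∃-syntax; Σ-syntax; _×_; _,_; proj₁; proj₂)
import Data.Product.Properties as Product
open import Data.Rational.Base as ℚ using (ℚ; 0ℚ; 1ℚ; ½)
import Data.Rational.Properties as ℚ
open import Data.Rational.Solver using (module +-*-Solver)
open import Data.Sum.Base as Sum using (_⊎_; inj₁; inj₂)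
import Data.Vec.Base as Vec
import Data.Vec.Properties as Vec
open import Function.Base using (_∘_; _$_; id)
open import Induction.WellFounded using (Acc; acc)
open import Level using (0ℓ)
open import Relation.Binary.Construct.Closure.ReflexiveTransitive
  using (Star; ε; _◅_; _◅◅_; kleisliStar; reverse)
open import Relation.Binary.Core using (Rel)
open import Relation.Binary.Definitions using
  (Decidable; Symmetric; Irreflexive; tri<; tri≈; tri>)
open import Relation.Binary.PropositionalEquality using
  (_≡_; _≢_; refl; sym; trans; cong; cong₂; subst; subst₂)
open import Relation.Nullary.Construct.Add.Supremum using (_⁺; ⊤⁺; [_])
open import Relation.Nullary.Decidable using
  (Dec; yes; no; does; map′; ¬?; _×-dec_; _⊎-dec_)
open import Relation.Nullary.Negation using (¬_; contradiction)

------------------------------------------------------------------------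
-- Real numbers as Cauchy sequences of rationals

Cauchy : (ℕ → ℚ) → Set
Cauchy x = ∀ δ → 0ℚ ℚ.< δ →
  ∃[ N ] (∀ m n → N ℕ.≤ m → N ℕ.≤ n → ℚ.∣ x m ℚ.- x n ∣ ℚ.≤ δ)

record ℝ : Set where
  constructor mkℝ
  field
    seq    : ℕ → ℚ
    cauchy : Cauchy seq

open ℝ public

infix 4 _<ᴿ_ _≤ᴿ_

_<ᴿ_ : Rel ℝ 0ℓ
x <ᴿ y = ∃[ δ ] 0ℚ ℚ.< δ × ∃[ N ] (∀ n → N ℕ.≤ n → seq x n ℚ.+ δ ℚ.≤ seq y n)

_≤ᴿ_ : Rel ℝ 0ℓ
x ≤ᴿ y = ∀ δ → 0ℚ ℚ.< δ → ∃[ N ] (∀ n → N ℕ.≤ n → seq x n ℚ.≤ seq y n ℚ.+ δ)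

*-pos : ∀ {p q} → 0ℚ ℚ.< p → 0ℚ ℚ.< q → 0ℚ ℚ.< p ℚ.* q
*-pos {p} {q} 0<p 0<q = subst (ℚ._< p ℚ.* q) (ℚ.*-zeroʳ p)
  (ℚ.*-monoʳ-<-pos p {{ℚ.positive 0<p}} 0<q)

*-mono-≤ : ∀ {p q r s} → 0ℚ ℚ.≤ r → 0ℚ ℚ.≤ q → p ℚ.≤ q → r ℚ.≤ s →
           p ℚ.* r ℚ.≤ q ℚ.* s
*-mono-≤ {p} {q} {r} {s} 0≤r 0≤q p≤q r≤s = ℚ.≤-trans
  (ℚ.*-monoʳ-≤-nonNeg r {{ℚ.nonNegative 0≤r}} p≤q)
  (ℚ.*-monoˡ-≤-nonNeg q {{ℚ.nonNegative 0≤q}} r≤s)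

∣x-x∣≡0 : ∀ q → ℚ.∣ q ℚ.- q ∣ ≡ 0ℚ
∣x-x∣≡0 q = cong ℚ.∣_∣ (ℚ.+-inverseʳ q)

-- A Cauchy condition that only holds up to a constant factor suffices.
cauchy-scale : ∀ (x : ℕ → ℚ) K → 0ℚ ℚ.< K →
  (∀ δ → 0ℚ ℚ.< δ → ∃[ N ] (∀ m n → N ℕ.≤ m → N ℕ.≤ n →
     ℚ.∣ x m ℚ.- x n ∣ ℚ.≤ K ℚ.* δ)) → Cauchy x
cauchy-scale x K 0<K h δ 0<δ =
  let N , b = h (1/K ℚ.* δ) (*-pos 0<1/K 0<δ)
  in  N , λ m n N≤m N≤n → subst (ℚ.∣ x m ℚ.- x n ∣ ℚ.≤_) eq (b m n N≤m N≤n)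
  where
  instance
    K>0 : ℚ.Positive K
    K>0 = ℚ.positive 0<K
    K≢0 : ℚ.NonZero K
    K≢0 = ℚ.pos⇒nonZero K
  1/K = ℚ.1/ K
  0<1/K : 0ℚ ℚ.< 1/K
  0<1/K = ℚ.positive⁻¹ 1/K {{ℚ.1/pos⇒pos K}}
  eq : K ℚ.* (1/K ℚ.* δ) ≡ δ
  eq = trans (sym (ℚ.*-assoc K 1/K δ))
       (trans (cong (ℚ._* δ) (ℚ.*-inverseʳ K)) (ℚ.*-identityˡ δ))

0<2 : 0ℚ ℚ.< 1ℚ ℚ.+ 1ℚ
0<2 = ℚ.positive⁻¹ (1ℚ ℚ.+ 1ℚ)

0<1 : 0ℚ ℚ.< 1ℚ
0<1 = ℚ.positive⁻¹ 1ℚ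

bounded : ∀ x → ∃[ M ] 0ℚ ℚ.< M ×
          ∃[ N ] (∀ n → N ℕ.≤ n → ℚ.∣ seq x n ∣ ℚ.≤ M)
bounded x with cauchy x 1ℚ 0<1
... | N , b = 1ℚ ℚ.+ ℚ.∣ seq x N ∣
            , ℚ.+-mono-<-≤ 0<1 (ℚ.0≤∣p∣ (seq x N))
            , N , λ n N≤n → ℚ.≤-trans
                (subst (λ q → ℚ.∣ q ∣ ℚ.≤ ℚ.∣ seq x n ℚ.- seq x N ∣ ℚ.+ ℚ.∣ seq x N ∣)
                  (eq (seq x n) (seq x N))
                  (ℚ.∣p+q∣≤∣p∣+∣q∣ (seq x n ℚ.- seq x N) (seq x N)))
                (ℚ.+-monoˡ-≤ ℚ.∣ seq x N ∣ (b n N N≤n ℕ.≤-refl))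
  where
  eq : ∀ a b → a ℚ.- b ℚ.+ b ≡ a
  eq = solve 2 (λ a b → a :- b :+ b := a) refl where open +-*-Solver

constℝ : ℚ → ℝ
constℝ q .seq _ = q
constℝ q .cauchy δ 0<δ = 0 , λ _ _ _ _ →
  subst (ℚ._≤ δ) (sym (∣x-x∣≡0 q)) (ℚ.<⇒≤ 0<δ)

0ℝ 1ℝ ½ℝ 3/2ℝ : ℝ
0ℝ   = constℝ 0ℚ
1ℝ   = constℝ 1ℚ
½ℝ   = constℝ ½
3/2ℝ = constℝ (ℤ.+ 3 ℚ./ 2)

infixl 6 _+ᴿ_ _-ᴿ_
infixl 7 _*ᴿ_
infix  8 -ᴿ_

_+ᴿ_ : ℝ → ℝ → ℝ
(x +ᴿ y) .seq n = seq x n ℚ.+ seq y n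
(x +ᴿ y) .cauchy = cauchy-scale (λ n → seq x n ℚ.+ seq y n) (1ℚ ℚ.+ 1ℚ) 0<2 λ δ 0<δ →
  let M , a = cauchy x δ 0<δ
      N , b = cauchy y δ 0<δ
  in  M ℕ.⊔ N , λ m n ≤m ≤n →
      subst₂ ℚ._≤_
        (cong ℚ.∣_∣ (eq₁ (seq x m) (seq x n) (seq y m) (seq y n))) (eq₂ δ)
        (ℚ.≤-trans
          (ℚ.∣p+q∣≤∣p∣+∣q∣ (seq x m ℚ.- seq x n) (seq y m ℚ.- seq y n))
          (ℚ.+-mono-≤
            (a m n (ℕ.m⊔n≤o⇒m≤o M N ≤m) (ℕ.m⊔n≤o⇒m≤o M N ≤n))
            (b m n (ℕ.m⊔n≤o⇒n≤o M N ≤m) (ℕ.m⊔n≤o⇒n≤o M N ≤n))))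
  where
  open +-*-Solver
  eq₁ : ∀ a a′ b b′ → (a ℚ.- a′) ℚ.+ (b ℚ.- b′) ≡ (a ℚ.+ b) ℚ.- (a′ ℚ.+ b′)
  eq₁ = solve 4 (λ a a′ b b′ → (a :- a′) :+ (b :- b′) := (a :+ b) :- (a′ :+ b′)) refl
  eq₂ : ∀ δ → δ ℚ.+ δ ≡ (1ℚ ℚ.+ 1ℚ) ℚ.* δ
  eq₂ = solve 1 (λ δ → δ :+ δ := (con 1ℚ :+ con 1ℚ) :* δ) refl

-ᴿ_ : ℝ → ℝ
(-ᴿ x) .seq n = ℚ.- seq x n
(-ᴿ x) .cauchy δ 0<δ =
  let N , b = cauchy x δ 0<δ
  in  N , λ m n N≤m N≤n → subst (λ q → ℚ.∣ q ∣ ℚ.≤ δ)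
                            (eq (seq x m) (seq x n)) (b n m N≤n N≤m)
  where
  open +-*-Solver
  eq : ∀ a b → b ℚ.- a ≡ (ℚ.- a) ℚ.- (ℚ.- b)
  eq = solve 2 (λ a b → b :- a := (:- a) :- (:- b)) refl

_-ᴿ_ : ℝ → ℝ → ℝ
x -ᴿ y = x +ᴿ (-ᴿ y)

_*ᴿ_ : ℝ → ℝ → ℝ
(x *ᴿ y) .seq n = seq x n ℚ.* seq y n
(x *ᴿ y) .cauchy =
  let A , 0<A , M  , a  = bounded x
      B , 0<B , M′ , a′ = bounded y
  in  cauchy-scale (λ n → seq x n ℚ.* seq y n) (A ℚ.+ B) (ℚ.+-mono-< 0<A 0<B) λ δ 0<δ →
  let N  , b  = cauchy x δ 0<δ
      N′ , b′ = cauchy y δ 0<δ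
  in  (M ℕ.⊔ M′) ℕ.⊔ (N ℕ.⊔ N′) , λ m n ≤m ≤n →
  let ≤m₁ = ℕ.m⊔n≤o⇒m≤o (M ℕ.⊔ M′) (N ℕ.⊔ N′) ≤m
      ≤m₂ = ℕ.m⊔n≤o⇒n≤o (M ℕ.⊔ M′) (N ℕ.⊔ N′) ≤m
      ≤n₁ = ℕ.m⊔n≤o⇒m≤o (M ℕ.⊔ M′) (N ℕ.⊔ N′) ≤n
      ≤n₂ = ℕ.m⊔n≤o⇒n≤o (M ℕ.⊔ M′) (N ℕ.⊔ N′) ≤n
      p = seq x m
      q = seq y m ℚ.- seq y n
      r = seq y n
      s = seq x m ℚ.- seq x n
      open ℚ.≤-Reasoning
  in  begin
    ℚ.∣ seq x m ℚ.* seq y m ℚ.- seq x n ℚ.* seq y n ∣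
      ≡⟨ cong ℚ.∣_∣ (eq (seq x m) (seq x n) (seq y m) (seq y n)) ⟩
    ℚ.∣ p ℚ.* q ℚ.+ r ℚ.* s ∣
      ≤⟨ ℚ.∣p+q∣≤∣p∣+∣q∣ (p ℚ.* q) (r ℚ.* s) ⟩
    ℚ.∣ p ℚ.* q ∣ ℚ.+ ℚ.∣ r ℚ.* s ∣
      ≡⟨ cong₂ ℚ._+_ (ℚ.∣p*q∣≡∣p∣*∣q∣ p q) (ℚ.∣p*q∣≡∣p∣*∣q∣ r s) ⟩
    ℚ.∣ p ∣ ℚ.* ℚ.∣ q ∣ ℚ.+ ℚ.∣ r ∣ ℚ.* ℚ.∣ s ∣
      ≤⟨ ℚ.+-mono-≤
           (*-mono-≤ (ℚ.0≤∣p∣ q) (ℚ.<⇒≤ 0<A)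
             (a m (ℕ.m⊔n≤o⇒m≤o M M′ ≤m₁))
             (b′ m n (ℕ.m⊔n≤o⇒n≤o N N′ ≤m₂) (ℕ.m⊔n≤o⇒n≤o N N′ ≤n₂)))
           (*-mono-≤ (ℚ.0≤∣p∣ s) (ℚ.<⇒≤ 0<B)
             (a′ n (ℕ.m⊔n≤o⇒n≤o M M′ ≤n₁))
             (b m n (ℕ.m⊔n≤o⇒m≤o N N′ ≤m₂) (ℕ.m⊔n≤o⇒m≤o N N′ ≤n₂))) ⟩
    A ℚ.* δ ℚ.+ B ℚ.* δ
      ≡⟨ ℚ.*-distribʳ-+ δ A B ⟨
    (A ℚ.+ B) ℚ.* δ ∎
  where
  eq : ∀ a a′ b b′ → a ℚ.* b ℚ.- a′ ℚ.* b′ ≡ a ℚ.* (b ℚ.- b′) ℚ.+ b′ ℚ.* (a ℚ.- a′)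
  eq = solve 4 (λ a a′ b b′ →
    a :* b :- a′ :* b′ := a :* (b :- b′) :+ b′ :* (a :- a′)) refl
    where open +-*-Solver

-- The value at 0 is irrelevant: the sequences inverted below are eventually
-- bounded away from 0.
invℚ : ℚ → ℚ
invℚ q with q ℚ.≟ 0ℚ
... | yes _   = 0ℚ
... | no  q≢0 = ℚ.1/_ q {{ℚ.≢-nonZero q≢0}}

invℚ-inverseʳ : ∀ {q} → 0ℚ ℚ.< q → q ℚ.* invℚ q ≡ 1ℚ
invℚ-inverseʳ {q} 0<q with q ℚ.≟ 0ℚ
... | yes refl = contradiction 0<q (ℚ.<-irrefl refl)
... | no  q≢0  = ℚ.*-inverseʳ q {{ℚ.≢-nonZero q≢0}}

invℚ-pos : ∀ {q} → 0ℚ ℚ.< q → 0ℚ ℚ.< invℚ q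
invℚ-pos {q} 0<q = ℚ.*-cancelˡ-<-nonNeg q {{ℚ.nonNegative (ℚ.<⇒≤ 0<q)}}
  (subst₂ ℚ._<_ (sym (ℚ.*-zeroʳ q)) (sym (invℚ-inverseʳ 0<q)) 0<1)

invℚ-antimono : ∀ {p q} → 0ℚ ℚ.< p → p ℚ.≤ q → invℚ q ℚ.≤ invℚ p
invℚ-antimono {p} {q} 0<p p≤q =
  subst₂ ℚ._≤_ eq₁ eq₂ (ℚ.*-monoʳ-≤-nonNeg (invℚ p ℚ.* invℚ q)
    {{ℚ.nonNegative (ℚ.<⇒≤ (*-pos (invℚ-pos 0<p) (invℚ-pos 0<q)))}} p≤q)
  where
  open +-*-Solver
  0<q = ℚ.<-≤-trans 0<p p≤q
  eq₁ : p ℚ.* (invℚ p ℚ.* invℚ q) ≡ invℚ q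
  eq₁ = trans (sym (ℚ.*-assoc p (invℚ p) (invℚ q)))
        (trans (cong (ℚ._* invℚ q) (invℚ-inverseʳ 0<p)) (ℚ.*-identityˡ (invℚ q)))
  eq₂ : q ℚ.* (invℚ p ℚ.* invℚ q) ≡ invℚ p
  eq₂ = trans (solve 3 (λ q a b → q :* (a :* b) := q :* b :* a) refl
                q (invℚ p) (invℚ q))
        (trans (cong (ℚ._* invℚ p) (invℚ-inverseʳ 0<q)) (ℚ.*-identityˡ (invℚ p)))

eventually-≥ : ∀ x ((δ , _ , N , _) : 0ℝ <ᴿ x) n → N ℕ.≤ n → δ ℚ.≤ seq x n
eventually-≥ x (δ , _ , N , b) n N≤n =
  subst (ℚ._≤ seq x n) (ℚ.+-identityˡ δ) (b n N≤n)

invℝ : ∀ x → 0ℝ <ᴿ x → ℝ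
invℝ x _ .seq n = invℚ (seq x n)
invℝ x 0<x@(d , 0<d , M , _) .cauchy =
  cauchy-scale (λ n → invℚ (seq x n)) K (*-pos (invℚ-pos 0<d) (invℚ-pos 0<d)) λ δ 0<δ →
  let N , b = cauchy x δ 0<δ
  in  M ℕ.⊔ N , λ m n ≤m ≤n →
  let p = seq x m
      q = seq x n
      d≤p = eventually-≥ x 0<x m (ℕ.m⊔n≤o⇒m≤o M N ≤m)
      d≤q = eventually-≥ x 0<x n (ℕ.m⊔n≤o⇒m≤o M N ≤n)
      0<p = ℚ.<-≤-trans 0<d d≤p
      0<q = ℚ.<-≤-trans 0<d d≤q
      0≤ip = ℚ.<⇒≤ (invℚ-pos 0<p)
      0≤iq = ℚ.<⇒≤ (invℚ-pos 0<q)
      0≤ipiq = ℚ.<⇒≤ (*-pos (invℚ-pos 0<p) (invℚ-pos 0<q))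
      open ℚ.≤-Reasoning
  in  begin
    ℚ.∣ invℚ p ℚ.- invℚ q ∣
      ≡⟨ cong ℚ.∣_∣ (eq p q 0<p 0<q) ⟩
    ℚ.∣ invℚ p ℚ.* invℚ q ℚ.* (q ℚ.- p) ∣
      ≡⟨ ℚ.∣p*q∣≡∣p∣*∣q∣ (invℚ p ℚ.* invℚ q) (q ℚ.- p) ⟩
    ℚ.∣ invℚ p ℚ.* invℚ q ∣ ℚ.* ℚ.∣ q ℚ.- p ∣
      ≡⟨ cong (ℚ._* ℚ.∣ q ℚ.- p ∣) (ℚ.0≤p⇒∣p∣≡p 0≤ipiq) ⟩
    invℚ p ℚ.* invℚ q ℚ.* ℚ.∣ q ℚ.- p ∣
      ≤⟨ *-mono-≤ (ℚ.0≤∣p∣ (q ℚ.- p))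
           (ℚ.<⇒≤ (*-pos (invℚ-pos 0<d) (invℚ-pos 0<d)))
           (*-mono-≤ 0≤iq (ℚ.<⇒≤ (invℚ-pos 0<d))
             (invℚ-antimono 0<d d≤p) (invℚ-antimono 0<d d≤q))
           (b n m (ℕ.m⊔n≤o⇒n≤o M N ≤n) (ℕ.m⊔n≤o⇒n≤o M N ≤m)) ⟩
    K ℚ.* δ ∎
  where
  K = invℚ d ℚ.* invℚ d
  eq : ∀ p q → 0ℚ ℚ.< p → 0ℚ ℚ.< q →
       invℚ p ℚ.- invℚ q ≡ invℚ p ℚ.* invℚ q ℚ.* (q ℚ.- p)
  eq p q 0<p 0<q = sym (trans
    (solve 4 (λ p q a b → a :* b :* (q :- p) := (q :* b) :* a :- (p :* a) :* b)
      refl p q (invℚ p) (invℚ q))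
    (cong₂ (λ a b → a ℚ.- b)
      (trans (cong (ℚ._* invℚ p) (invℚ-inverseʳ 0<q)) (ℚ.*-identityˡ (invℚ p)))
      (trans (cong (ℚ._* invℚ q) (invℚ-inverseʳ 0<p)) (ℚ.*-identityˡ (invℚ q)))))
    where open +-*-Solver

∑ ∏ : List ℝ → ℝ
∑ = foldr _+ᴿ_ 0ℝ
∏ = foldr _*ᴿ_ 1ℝ

+ᴿ-pos : ∀ x y → 0ℝ <ᴿ x → 0ℝ <ᴿ y → 0ℝ <ᴿ x +ᴿ y
+ᴿ-pos x y p@(d , 0<d , M , _) q@(e , 0<e , N , _) =
  d ℚ.+ e , ℚ.+-mono-< 0<d 0<e , M ℕ.⊔ N , λ n ≤n →
  subst (ℚ._≤ seq x n ℚ.+ seq y n) (sym (ℚ.+-identityˡ (d ℚ.+ e)))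
    (ℚ.+-mono-≤ (eventually-≥ x p n (ℕ.m⊔n≤o⇒m≤o M N ≤n))
                (eventually-≥ y q n (ℕ.m⊔n≤o⇒n≤o M N ≤n)))

*ᴿ-pos : ∀ x y → 0ℝ <ᴿ x → 0ℝ <ᴿ y → 0ℝ <ᴿ x *ᴿ y
*ᴿ-pos x y p@(d , 0<d , M , _) q@(e , 0<e , N , _) =
  d ℚ.* e , *-pos 0<d 0<e , M ℕ.⊔ N , λ n ≤n →
  subst (ℚ._≤ seq x n ℚ.* seq y n) (sym (ℚ.+-identityˡ (d ℚ.* e)))
    (*-mono-≤ (ℚ.<⇒≤ 0<e)
      (ℚ.≤-trans (ℚ.<⇒≤ 0<d) (eventually-≥ x p n (ℕ.m⊔n≤o⇒m≤o M N ≤n)))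
      (eventually-≥ x p n (ℕ.m⊔n≤o⇒m≤o M N ≤n))
      (eventually-≥ y q n (ℕ.m⊔n≤o⇒n≤o M N ≤n)))

0<1ℝ : 0ℝ <ᴿ 1ℝ
0<1ℝ = 1ℚ , 0<1 , 0 , λ _ _ → ℚ.≤-reflexive (ℚ.+-identityˡ 1ℚ)

+ᴿ-0-pos : ∀ x → 0ℝ <ᴿ x → 0ℝ <ᴿ x +ᴿ 0ℝ
+ᴿ-0-pos x (d , 0<d , N , b) = d , 0<d , N , λ n ≤n →
  subst (0ℚ ℚ.+ d ℚ.≤_) (sym (ℚ.+-identityʳ (seq x n))) (b n ≤n)

∑-pos : ∀ {A : Set} (f : A → ℝ) → (∀ a → 0ℝ <ᴿ f a) →
        ∀ {a} {as : List A} → a ∈ as → 0ℝ <ᴿ ∑ (map f as)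
∑-pos f 0<f {as = a ∷ []}     _ = +ᴿ-0-pos (f a) (0<f a)
∑-pos f 0<f {as = a ∷ b ∷ as} _ =
  +ᴿ-pos (f a) (∑ (map f (b ∷ as))) (0<f a) (∑-pos f 0<f {as = b ∷ as} (here refl))

∏-pos : ∀ {A : Set} (f : A → ℝ) → (∀ a → 0ℝ <ᴿ f a) →
        ∀ (as : List A) → 0ℝ <ᴿ ∏ (map f as)
∏-pos f 0<f []       = 0<1ℝ
∏-pos f 0<f (a ∷ as) = *ᴿ-pos (f a) (∏ (map f as)) (0<f a) (∏-pos f 0<f as)

------------------------------------------------------------------------
-- Decidability of reachability, and bounded search through lists

module _ {n} {R : Rel (Fin n) 0ℓ} (R? : Decidable R) where

  -- There is a walk whose inner vertices are taken from the given list
  -- (the Floyd–Warshall recursion).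
  Via : List (Fin n) → Rel (Fin n) 0ℓ
  Via []       u v = u ≡ v ⊎ R u v
  Via (w ∷ ws) u v = Via ws u v ⊎ (Via ws u w × Via ws w v)

  via? : ∀ ws → Decidable (Via ws)
  via? []       u v = (u Fin.≟ v) ⊎-dec R? u v
  via? (w ∷ ws) u v = via? ws u v ⊎-dec (via? ws u w ×-dec via? ws w v)

  via-base : ∀ ws {u v} → u ≡ v ⊎ R u v → Via ws u v
  via-base []       p = p
  via-base (w ∷ ws) p = inj₁ (via-base ws p)

  via-sound : ∀ ws {u v} → Via ws u v → Star R u v
  via-sound []       (inj₁ refl)    = ε
  via-sound []       (inj₂ r)       = r ◅ ε
  via-sound (w ∷ ws) (inj₁ p)       = via-sound ws p
  via-sound (w ∷ ws) (inj₂ (p , q)) = via-sound ws p ◅◅ via-sound ws q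

  via-trans : ∀ {w ws} → w ∈ ws → ∀ {u v} → Via ws u w → Via ws w v → Via ws u v
  via-trans (here refl) p q = inj₂ (Sum.[ id , proj₁ ] p , Sum.[ id , proj₂ ] q)
  via-trans (there i) (inj₁ p)       (inj₁ q)       = inj₁ (via-trans i p q)
  via-trans (there i) (inj₁ p)       (inj₂ (q , r)) = inj₂ (via-trans i p q , r)
  via-trans (there i) (inj₂ (p , q)) (inj₁ r)       = inj₂ (p , via-trans i q r)
  via-trans (there i) (inj₂ (p , _)) (inj₂ (_ , q)) = inj₂ (p , q)

  via-complete : ∀ {u v} → Star R u v → Via (allFin n) u v
  via-complete ε        = via-base (allFin n) (inj₁ refl)
  via-complete (r ◅ rs) =
    via-trans (∈-allFin _) (via-base (allFin n) (inj₂ r)) (via-complete rs)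

  star? : Decidable (Star R)
  star? u v = map′ (via-sound (allFin n)) via-complete (via? (allFin n) u v)

search : ∀ {n} {P : List (Fin n) → Set} → (∀ xs → Dec (P xs)) →
         ∀ N → Dec (∃[ xs ] length xs ℕ.≤ N × P xs)
search {P = P} P? zero = map′ (λ p → [] , z≤n , p) (λ { ([] , _ , p) → p }) (P? [])
search {P = P} P? (suc N) =
  map′ (λ { (inj₁ p) → [] , z≤n , p
          ; (inj₂ (x , xs , l , p)) → x ∷ xs , s≤s l , p })
       (λ { ([] , _ , p) → inj₁ p
          ; (x ∷ xs , s≤s l , p) → inj₂ (x , xs , l , p) })
       (P? [] ⊎-dec Fin.any? (λ x → search (λ xs → P? (x ∷ xs)) N))

lookup-injective : ∀ {A : Set} {xs : List A} → Unique xs →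
                   ∀ i j → lookup xs i ≡ lookup xs j → i ≡ j
lookup-injective (x∉ ∷ u) zero    zero    _ = refl
lookup-injective (x∉ ∷ u) zero    (suc j) p = contradiction p (All.lookup x∉ (∈-lookup j))
lookup-injective (x∉ ∷ u) (suc i) zero    p = contradiction (sym p) (All.lookup x∉ (∈-lookup i))
lookup-injective (x∉ ∷ u) (suc i) (suc j) p = cong suc (lookup-injective u i j p)

unique-length : ∀ {n} {xs : List (Fin n)} → Unique xs → length xs ℕ.≤ n
unique-length u = Fin.injective⇒≤ (λ {i} {j} → lookup-injective u i j)

unique? : ∀ {n} (xs : List (Fin n)) → Dec (Unique xs)
unique? = U.unique?
  where import Data.List.Relation.Unary.Unique.DecPropositional Fin._≟_ as U

------------------------------------------------------------------------
-- Finite simple graphs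

record Graph : Set₁ where
  field
    order    : ℕ
    _∼_      : Rel (Fin order) 0ℓ
    _∼?_     : Decidable _∼_
    ∼-sym    : Symmetric _∼_
    ∼-irrefl : Irreflexive _≡_ _∼_

  Vertex : Set
  Vertex = Fin order

Connected : Graph → Set
Connected G = 0 ℕ.< order × (∀ u v → Star _∼_ u v)
  where open Graph G

-- The cycle x , xs , x.
IsCycle : (G : Graph) → Graph.Vertex G → List (Graph.Vertex G) → Set
IsCycle G x xs = 2 ℕ.≤ length xs × Unique (x ∷ xs) × Linked _∼_ (x ∷ xs ∷ʳ x)
  where open Graph G

Acyclic : Graph → Set
Acyclic G = ¬ (∃[ x ] ∃[ xs ] IsCycle G x xs)

IsTree : Graph → Set
IsTree G = Connected G × Acyclic G

connected? : ∀ G → Dec (Connected G)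
connected? G = (0 ℕ.<? order) ×-dec Fin.all? λ u → Fin.all? λ v → star? _∼?_ u v
  where open Graph G

cycle? : ∀ G → Dec (∃[ x ] ∃[ xs ] IsCycle G x xs)
cycle? G = Fin.any? λ x →
  map′ (λ (xs , _ , c) → xs , c)
       (λ { (xs , c@(_ , (_ ∷ u) , _)) → xs , unique-length u , c })
       (search (λ xs → (2 ℕ.≤? length xs)
                         ×-dec unique? (x ∷ xs)
                         ×-dec linked? _∼?_ (x ∷ xs ∷ʳ x)) order)
  where open Graph G

isTree? : ∀ G → Dec (IsTree G)
isTree? G = connected? G ×-dec ¬? (cycle? G)

subsets : ∀ n → List (Subset n)
subsets zero    = Vec.[] ∷ []
subsets (suc n) = map (outside Vec.∷_) (subsets n) ++ map (inside Vec.∷_) (subsets n)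

∈-subsets : ∀ {n} (S : Subset n) → S ∈ subsets n
∈-subsets Vec.[]            = here refl
∈-subsets (outside Vec.∷ S) = ∈-++⁺ˡ (∈-map⁺ _ (∈-subsets S))
∈-subsets (inside  Vec.∷ S) = ∈-++⁺ʳ (map _ (subsets _)) (∈-map⁺ _ (∈-subsets S))

------------------------------------------------------------------------
-- Toughness

module _ (G : Graph) where
  open Graph G

  Avoiding : Subset order → Rel Vertex 0ℓ
  Avoiding S u v = u Subset.∉ S × v Subset.∉ S × u ∼ v

  avoiding? : ∀ S → Decidable (Avoiding S)
  avoiding? S u v = ¬? (u Subset.∈? S) ×-dec ¬? (v Subset.∈? S) ×-dec (u ∼? v)

  -- The vertex set of the component of u in G − S, provided that u ∉ S.
  component : Subset order → Vertex → Subset order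
  component S u = Vec.tabulate λ v → does (star? (avoiding? S) u v)

  components : Subset order → List (Subset order)
  components S = deduplicate (Vec.≡-dec Bool._≟_)
    (map (component S) (filter (λ u → ¬? (u Subset.∈? S)) (allFin order)))

  c[G-_] : Subset order → ℕ
  c[G- S ] = length (components S)

  -- ∣S∣ / c(G − S) if S disconnects G, and ∞ otherwise.
  cutRatio : Subset order → ℚ ⁺
  cutRatio S with 1 ℕ.<? c[G- S ]
  ... | yes 1<c = [ ℚ._/_ (ℤ.+ ∣ S ∣) c[G- S ] {{ℕ.>-nonZero (ℕ.<⇒≤ 1<c)}} ]
  ... | no  _   = ⊤⁺

_⊓⁺_ : ℚ ⁺ → ℚ ⁺ → ℚ ⁺
⊤⁺    ⊓⁺ y     = y
[ p ] ⊓⁺ ⊤⁺    = [ p ]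
[ p ] ⊓⁺ [ q ] = [ p ℚ.⊓ q ]

-- No vertex set disconnects a complete graph, so complete graphs get ⊤⁺.
τ : Graph → ℝ ⁺
τ G = Maybe.map constℝ (foldr _⊓⁺_ ⊤⁺ (map (cutRatio G) (subsets (Graph.order G))))

------------------------------------------------------------------------
-- Edges and spanning trees

module _ (G : Graph) where
  open Graph G

  isEdge? : (e : Vertex × Vertex) → Dec (proj₁ e Fin.< proj₂ e × proj₁ e ∼ proj₂ e)
  isEdge? (u , v) = (u Fin.<? v) ×-dec (u ∼? v)

  -- Each edge is listed once, with its smaller end first.
  edges : List (Vertex × Vertex)
  edges = filter isEdge? (cartesianProduct (allFin order) (allFin order))

  size : ℕ
  size = length edges

  Edge : Set
  Edge = Fin size

  ends : Edge → Vertex × Vertex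
  ends = lookup edges

  Joins : Edge → Rel Vertex 0ℓ
  Joins e u v = ends e ≡ (u , v) ⊎ ends e ≡ (v , u)

  joins? : ∀ e → Decidable (Joins e)
  joins? e u v = (ends e ≟ (u , v)) ⊎-dec (ends e ≟ (v , u))
    where _≟_ = Product.≡-dec Fin._≟_ Fin._≟_

  Incident : Vertex → Edge → Set
  Incident v e = v ≡ proj₁ (ends e) ⊎ v ≡ proj₂ (ends e)

  incident? : ∀ v e → Dec (Incident v e)
  incident? v e = (v Fin.≟ proj₁ (ends e)) ⊎-dec (v Fin.≟ proj₂ (ends e))

  ends-edge : ∀ e → proj₁ (ends e) Fin.< proj₂ (ends e)
  ends-edge e = proj₁ $ proj₂ $
    ∈-filter⁻ isEdge? {xs = cartesianProduct (allFin order) (allFin order)}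
      (∈-lookup {xs = edges} e)

  edge-of-< : ∀ {u v} → u Fin.< v → u ∼ v → ∃[ e ] ends e ≡ (u , v)
  edge-of-< {u} {v} u<v u∼v = index uv∈ , sym (lookup-index uv∈)
    where
    uv∈ : (u , v) ∈ edges
    uv∈ = ∈-filter⁺ isEdge?
      (∈-cartesianProduct⁺ (∈-allFin u) (∈-allFin v)) (u<v , u∼v)

  edge-of : ∀ {u v} → u ∼ v → ∃[ e ] Joins e u v
  edge-of {u} {v} u∼v with Fin.<-cmp u v
  ... | tri< u<v _ _  = let e , p = edge-of-< u<v u∼v in e , inj₁ p
  ... | tri≈ _ refl _ = contradiction u∼v (∼-irrefl refl)
  ... | tri> _ _ v<u  = let e , p = edge-of-< v<u (∼-sym u∼v) in e , inj₂ p

  joins-irrefl : ∀ e {u} → ¬ Joins e u u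
  joins-irrefl e {u} j = Fin.<-irrefl {x = u} refl
    (subst (λ f → proj₁ f Fin.< proj₂ f) {y = u , u} (Sum.[ id , id ] j) (ends-edge e))

  -- The graph (V , T).
  spanningSubgraph : Subset size → Graph
  spanningSubgraph T = record
    { order    = order
    ; _∼_      = λ u v → ∃[ e ] e Subset.∈ T × Joins e u v
    ; _∼?_     = λ u v → Fin.any? λ e → (e Subset.∈? T) ×-dec joins? e u v
    ; ∼-sym    = λ (e , e∈T , j) → e , e∈T , Sum.swap j
    ; ∼-irrefl = λ { refl (e , _ , j) → joins-irrefl e j }
    }

  IsSpanningTree : Subset size → Set
  IsSpanningTree T = IsTree (spanningSubgraph T)

  spanningTrees : List (Subset size)
  spanningTrees = filter (λ T → isTree? (spanningSubgraph T)) (subsets size)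

  linked⇒star : ∀ {R : Rel Vertex 0ℓ} {u v} ws → Linked R (u ∷ ws ∷ʳ v) → Star R u v
  linked⇒star []       (r ∷ _)  = r ◅ ε
  linked⇒star (w ∷ ws) (r ∷ rs) = r ◅ linked⇒star ws rs

  joins-unique : ∀ e {u v w z} → Joins e u v → Joins e w z → w ≡ u ⊎ w ≡ v
  joins-unique e (inj₁ p) (inj₁ q) = inj₁ (cong proj₁ (trans (sym q) p))
  joins-unique e (inj₁ p) (inj₂ q) = inj₂ (cong proj₂ (trans (sym q) p))
  joins-unique e (inj₂ p) (inj₁ q) = inj₂ (cong proj₁ (trans (sym q) p))
  joins-unique e (inj₂ p) (inj₂ q) = inj₁ (cong proj₂ (trans (sym q) p))

  joins-swap : ∀ e {u v} → Joins e u v → Joins e v u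
  joins-swap e = Sum.swap

  module _ (T : Subset size) (e : Edge) {x y : Vertex} (exy : Joins e x y) where

    _∼T_ = Graph._∼_ (spanningSubgraph T)
    _∼T′_ = Graph._∼_ (spanningSubgraph (T Subset.- e))

    survives : ∀ {a b} → a ≢ x → a ≢ y → a ∼T b → a ∼T′ b
    survives a≢x a≢y (e′ , e′∈T , j) = e′ , Subset.x∈p∧x≢y⇒x∈p-y e′∈T
      (λ { refl → Sum.[ a≢x , a≢y ] (joins-unique e exy j) }) , j

    detour : ∀ ws {w} → All (λ a → a ≢ x × a ≢ y) (w ∷ ws) →
             Linked _∼T_ (w ∷ ws ∷ʳ x) → Linked _∼T′_ (w ∷ ws ∷ʳ x)
    detour []       ((a , b) ∷ _)  (r ∷ _)  = survives a b r ∷ [-]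
    detour (_ ∷ ws) ((a , b) ∷ ps) (r ∷ rs) = survives a b r ∷ detour ws ps rs

    reroute : Star _∼T′_ y x → ∀ {a b} → a ∼T b → Star _∼T′_ a b
    reroute yx {a} {b} (e′ , e′∈T , j) with e′ Fin.≟ e
    ... | no e′≢e = (e′ , Subset.x∈p∧x≢y⇒x∈p-y e′∈T e′≢e , j) ◅ ε
    ... | yes refl with joins-unique e exy j | joins-unique e exy (joins-swap e j)
    ...   | inj₁ refl | inj₁ refl = ε
    ...   | inj₁ refl | inj₂ refl =
      reverse (Graph.∼-sym (spanningSubgraph (T Subset.- e))) yx
    ...   | inj₂ refl | inj₁ refl = yx
    ...   | inj₂ refl | inj₂ refl = ε

  -- Deleting an edge of a cycle preserves connectedness.
  shrink : ∀ T → Connected (spanningSubgraph T) →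
    ∃[ x ] ∃[ xs ] IsCycle (spanningSubgraph T) x xs →
    ∃[ e ] e Subset.∈ T × Connected (spanningSubgraph (T Subset.- e))
  shrink T _ (x , [] , () , _)
  shrink T _ (x , _ ∷ [] , s≤s () , _)
  shrink T (0<n , conn)
    (x , y ∷ z ∷ zs , _ , ((x≢y ∷ x∉) ∷ y∉ ∷ _) , (e , e∈T , exy) ∷ r ∷ rs) =
    e , e∈T , 0<n , λ u v → kleisliStar id (reroute T e exy yx) (conn u v)
    where
    avoid : All (λ a → a ≢ x × a ≢ y) (z ∷ zs)
    avoid = All.zipWith (λ (p , q) → p ∘ sym , q ∘ sym) (x∉ , y∉)
    T′ = spanningSubgraph (T Subset.- e)
    z≢ = All.head avoid
    yx : Star (Graph._∼_ T′) y x
    yx = Graph.∼-sym T′ (survives T e exy (proj₁ z≢) (proj₂ z≢)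
                          (Graph.∼-sym (spanningSubgraph T) r))
         ◅ linked⇒star zs (detour T e exy zs avoid rs)

  prune : ∀ T → Acc ℕ._<_ ∣ T ∣ → Connected (spanningSubgraph T) → ∃ IsSpanningTree
  prune T (acc rec) conn with cycle? (spanningSubgraph T)
  ... | no  acyclic = T , conn , acyclic
  ... | yes cyc with shrink T conn cyc
  ...   | e , e∈T , conn′ =
    prune (T Subset.- e) (rec (Subset.x∈p⇒∣p-x∣<∣p∣ e∈T)) conn′

  spanningTree-exists : Connected G → ∃[ T ] T ∈ spanningTrees
  spanningTree-exists (0<n , conn) =
    let T , t = prune Subset.⊤ (ℕ.<-wellFounded _)
                  (0<n , λ u v → kleisliStar id step (conn u v))
    in  T , ∈-filter⁺ (λ T → isTree? (spanningSubgraph T)) (∈-subsets T) t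
    where
    step : ∀ {u v} → u ∼ v → Star (Graph._∼_ (spanningSubgraph Subset.⊤)) u v
    step u∼v = let e , j = edge-of u∼v in (e , Subset.∈⊤ , j) ◅ ε

------------------------------------------------------------------------
-- Resistance curvature

module _ (G : Graph) (conn : Connected G) where
  open Graph G

  Weights : Set
  Weights = Σ[ c ∈ (Edge G → ℝ) ] (∀ e → 0ℝ <ᴿ c e)

  treeWeight : Weights → Subset (size G) → ℝ
  treeWeight (c , _) T = ∏ (map c (filter (Subset._∈? T) (allFin (size G))))

  treeSum : Weights → ℝ
  treeSum c = ∑ (map (treeWeight c) (spanningTrees G))

  treeSumThrough : Weights → Edge G → ℝ
  treeSumThrough c e =
    ∑ (map (treeWeight c) (filter (e Subset.∈?_) (spanningTrees G)))

  treeSum-pos : ∀ c → 0ℝ <ᴿ treeSum c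
  treeSum-pos w@(c , 0<c) = ∑-pos (treeWeight w)
    (λ T → ∏-pos c 0<c (filter (Subset._∈? T) (allFin (size G))))
    (proj₂ (spanningTree-exists G conn))

  relativeResistance : Weights → Edge G → ℝ
  relativeResistance c e = treeSumThrough c e *ᴿ invℝ (treeSum c) (treeSum-pos c)

  curvature : Weights → Vertex → ℝ
  curvature c v = 1ℝ -ᴿ ½ℝ *ᴿ
    ∑ (map (relativeResistance c) (filter (incident? G v) (allFin (size G))))

  ResistanceNonnegative : Set
  ResistanceNonnegative = Σ[ c ∈ Weights ] (∀ v → 0ℝ ≤ᴿ curvature c v)

{-# OPTIONS --safe #-}

-- The example has s hubs, adjacent to every other vertex, a clique of
-- m = 2s + 3 cores, and m leaves, the i-th leaf being adjacent to the i-th core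
-- and to the hubs.
--
-- Not RN: the relative resistances are the edge probabilities of a random
-- spanning tree, so nonnegative curvature says that every vertex has expected
-- degree at most 2.  Weight hubs by 2, cores by 1 and leaves by 0.  Every edge
-- then has end weights summing to at least 2, except the m core–leaf edges,
-- where the sum is 1, so a spanning tree has weighted degree sum at least
-- 2(s + 2m − 1) − m = 8s + 7, more than the 2(2s + m) = 8s + 6 allowed.
--
-- Toughness: a disconnecting set consists of all s hubs, k cores and possibly
-- some leaves, and leaves at most k + 1 ≤ m + 1 components; hence
-- τ ≥ (s + m) / (m + 1) = 3(s + 1) / (2s + 4), which tends to 3/2.

module Submission where

import Data.Bool.Properties as Bool
open import Data.Empty using (⊥)
open import Data.Fin.Base as Fin using (Fin; zero; suc; splitAt; join)
import Data.Fin.Properties as Fin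
open import Data.Fin.Subset as Subset using (Subset; ∣_∣)
import Data.Fin.Subset.Properties as Subset
open import Data.Integer.Base as ℤ using (+_; -[1+_]; +≤+)
import Data.Integer.Properties as ℤ
open import Data.List.Base using
  (List; []; _∷_; _++_; map; foldr; filter; length; lookup; allFin; cartesianProduct)
import Data.List.Properties as List
open import Data.List.Membership.Propositional using (_∈_)
open import Data.List.Membership.Propositional.Properties using
  (∈-filter⁺; ∈-filter⁻; ∈-lookup; ∈-allFin; ∈-map⁺; ∈-map⁻; ∈-++⁺ˡ; ∈-++⁺ʳ;
   ∈-deduplicate⁻)
open import Data.List.Relation.Binary.Subset.Propositional using (_⊆_)
open import Data.List.Relation.Unary.All as All using (All; []; _∷_)
import Data.List.Relation.Unary.All.Properties as All
open import Data.List.Relation.Unary.AllPairs using ([]; _∷_)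
open import Data.List.Relation.Unary.Any using (here; there; index)
open import Data.List.Relation.Unary.Any.Properties using (lookup-index)
import Data.List.Relation.Unary.Unique.DecPropositional.Properties as DecUnique
open import Data.List.Relation.Unary.Unique.Propositional using (Unique)
import Data.List.Relation.Unary.Unique.Propositional.Properties as Unique
import Data.Maybe.Base as Maybe
open import Data.Nat.Base as ℕ using (ℕ; zero; suc; z≤n; s≤s; NonZero)
open import Data.Nat.ListAction using (sum)
import Data.Nat.Properties as ℕ
open import Data.Nat.Tactic.RingSolver using (solve-∀)
open import Data.Product.Base using (∃-syntax; Σ-syntax; _×_; _,_; proj₁; proj₂)
open import Data.Rational.Base as ℚ using (ℚ; 0ℚ; 1ℚ; ½)
import Data.Rational.Properties as ℚ
open import Data.Rational.Solver using (module +-*-Solver)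
open import Data.Rational.Unnormalised.Base as ℚᵘ using (mkℚᵘ)
import Data.Rational.Unnormalised.Properties as ℚᵘ
open import Data.Sum.Base as Sum using (_⊎_; inj₁; inj₂)
import Data.Sum.Properties as Sum
open import Data.Unit.Base using (⊤; tt)
import Data.Vec.Properties as Vec
open import Function.Base using (_∘_; id)
open import Function.Bundles using (mk⇔)
open import Level using (0ℓ)
open import Relation.Binary.Construct.Add.Supremum.Strict using (_<⁺_; [_]; [_]<⊤⁺)
open import Relation.Binary.Construct.Closure.ReflexiveTransitive using
  (Star; _◅_; _◅◅_; reverse) renaming (ε to done)
open import Relation.Binary.Core using (Rel; REL)
open import Relation.Binary.Definitions using (Decidable)
open import Relation.Binary.PropositionalEquality using
  (_≡_; _≢_; refl; sym; trans; cong; cong₂; subst; subst₂; module ≡-Reasoning)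
open import Relation.Nullary.Construct.Add.Supremum using (_⁺; ⊤⁺; [_])
open import Relation.Nullary.Decidable using (Dec; yes; no; ¬?; _×-dec_; does-⇔)
open import Relation.Nullary.Negation using (¬_; contradiction)
import Relation.Unary as Unary
open import Defs

open import Algebra.Definitions.RawMonoid ℚ.+-0-rawMonoid using () renaming (_×_ to _·_)
open import Algebra.Properties.CommutativeMonoid.Mult ℚ.+-0-commutativeMonoid using
  (×-homo-+; ×-distrib-+; ×-assocˡ)

private variable
  A B : Set

-- Finite combinatorics

unique-⊆⇒length≤ : {xs ys : List A} → Unique xs → xs ⊆ ys → length xs ℕ.≤ length ys
unique-⊆⇒length≤ {xs = xs} {ys} u xs⊆ys = Fin.injective⇒≤ {f = f} λ {i} {j} eq →
  lookup-injective u i j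
    (trans (lookup-index (xs⊆ys (∈-lookup i)))
    (trans (cong (lookup ys) eq) (sym (lookup-index (xs⊆ys (∈-lookup j))))))
  where
  f : Fin (length xs) → Fin (length ys)
  f i = index (xs⊆ys (∈-lookup i))

-- Edges merge the classes of a labelling one at a time, each merge losing at
-- most one label.
merge : ∀ {n} (es : List (Fin n × Fin n)) →
  Σ[ f ∈ (Fin n → Fin n) ] All (λ (u , v) → f u ≡ f v) es ×
  ∃[ L ] Unique L × All (λ (x : Fin n) → ∃[ w ] f w ≡ x) L × n ℕ.≤ length L ℕ.+ length es
merge {n} [] = (λ v → v) , [] , allFin n , Unique.allFin⁺ n , All.tabulate (λ {x} _ → x , refl)
  , ℕ.≤-reflexive (sym (trans (ℕ.+-identityʳ _) (List.length-tabulate {n = n} (λ v → v))))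
merge {n} ((u , v) ∷ es) with merge es
... | f , f-es , L , uniq , im , n≤ =
  f′ , edge ∷ All.map (cong relabel) f-es , L′ , Unique.filter⁺ ≢fu uniq
     , All.tabulate (λ x∈ → lift-im (∈-filter⁻ ≢fu {xs = L} x∈)) , bound
  where
  relabel : Fin n → Fin n
  relabel x with x Fin.≟ f u
  ... | yes _ = f v
  ... | no  _ = x
  f′ : Fin n → Fin n
  f′ w = relabel (f w)
  edge : f′ u ≡ f′ v
  edge with f u Fin.≟ f u | f v Fin.≟ f u
  ... | yes _ | yes _ = refl
  ... | yes _ | no  _ = refl
  ... | no  p | _     = contradiction refl p
  ≢fu = λ x → ¬? (x Fin.≟ f u)
  -- If `f u ≡ f v` already, this drops a label that is still attained. That is harmless: `L` lists
  -- some attained labels, and the bound allows one loss per edge.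
  L′ = filter ≢fu L
  lift-im : ∀ {x} → x ∈ L × x ≢ f u → ∃[ w ] f′ w ≡ x
  lift-im (x∈L , x≢) with All.lookup im x∈L
  ... | w , refl = w , eq
    where
    eq : f′ w ≡ f w
    eq with f w Fin.≟ f u
    ... | yes p = contradiction p x≢
    ... | no  _ = refl
  L⊆ : L ⊆ f u ∷ L′
  L⊆ {x} x∈ with x Fin.≟ f u
  ... | yes x≡ = here x≡
  ... | no  x≢ = there (∈-filter⁺ ≢fu x∈ x≢)
  bound : n ℕ.≤ length L′ ℕ.+ suc (length es)
  bound = ℕ.≤-trans n≤ (ℕ.≤-trans (ℕ.+-monoˡ-≤ (length es) (unique-⊆⇒length≤ uniq L⊆))
    (ℕ.≤-reflexive (sym (ℕ.+-suc (length L′) (length es)))))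

chosen : ∀ {n} → Subset n → List (Fin n)
chosen T = filter (Subset._∈? T) (allFin _)

module _ (G : Graph) where
  open Graph G

  -- The labelling from `merge` agrees on the ends of every chosen edge, hence along walks.
  -- Connectedness of `T` then leaves at most one label.
  order≤1+edges : ∀ T → Connected (spanningSubgraph G T) → order ℕ.≤ suc (length (chosen T))
  order≤1+edges T (_ , conn) with merge (map (ends G) (chosen T))
  ... | f , f-es , L , uniq , im , n≤ = ℕ.≤-trans n≤
      (ℕ.+-mono-≤ (short L uniq im) (ℕ.≤-reflexive (List.length-map (ends G) (chosen T))))
    where
    step : ∀ {u v} → Graph._∼_ (spanningSubgraph G T) u v → f u ≡ f v
    step (e , e∈T , j)
      with All.lookup (All.map⁻ f-es) (∈-filter⁺ (Subset._∈? T) (∈-allFin e) e∈T) | j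
    ... | eq | inj₁ refl = eq
    ... | eq | inj₂ refl = sym eq
    const : ∀ {u v} → Star (Graph._∼_ (spanningSubgraph G T)) u v → f u ≡ f v
    const done     = refl
    const (r ◅ rs) = trans (step r) (const rs)
    short : ∀ L → Unique L → All (λ x → ∃[ w ] f w ≡ x) L → length L ℕ.≤ 1
    short []          _              _ = z≤n
    short (_ ∷ [])    _              _ = s≤s z≤n
    short (_ ∷ _ ∷ _) ((x≢y ∷ _) ∷ _) ((w , refl) ∷ (w′ , refl) ∷ _) =
      contradiction (const (conn w w′)) x≢y

-- Sums of rationals over lists

Σℚ : (A → ℚ) → List A → ℚ
Σℚ f []       = 0ℚ
Σℚ f (x ∷ xs) = f x ℚ.+ Σℚ f xs

-- Real operations act termwise, so fixing an index turns real sums into rational ones. The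
-- averaging argument runs at a single index.
seq-∑ : (f : A → ℝ) (xs : List A) (n : ℕ) →
        seq (∑ (map f xs)) n ≡ Σℚ (λ x → seq (f x) n) xs
seq-∑ f []       n = refl
seq-∑ f (x ∷ xs) n = cong (seq (f x) n ℚ.+_) (seq-∑ f xs n)

Σℚ-cong : {f g : A → ℚ} (xs : List A) → (∀ x → f x ≡ g x) → Σℚ f xs ≡ Σℚ g xs
Σℚ-cong []       f≡g = refl
Σℚ-cong (x ∷ xs) f≡g = cong₂ ℚ._+_ (f≡g x) (Σℚ-cong xs f≡g)

Σℚ-mono : {f g : A → ℚ} {xs : List A} → All (λ x → f x ℚ.≤ g x) xs → Σℚ f xs ℚ.≤ Σℚ g xs
Σℚ-mono []       = ℚ.≤-refl
Σℚ-mono (p ∷ ps) = ℚ.+-mono-≤ p (Σℚ-mono ps)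

Σℚ-*ʳ : ∀ (f : A → ℚ) xs q → Σℚ f xs ℚ.* q ≡ Σℚ (λ x → f x ℚ.* q) xs
Σℚ-*ʳ f []       q = ℚ.*-zeroˡ q
Σℚ-*ʳ f (x ∷ xs) q =
  trans (ℚ.*-distribʳ-+ q (f x) (Σℚ f xs)) (cong (f x ℚ.* q ℚ.+_) (Σℚ-*ʳ f xs q))

Σℚ-const : ∀ (xs : List A) q → Σℚ (λ _ → q) xs ≡ length xs · q
Σℚ-const []       q = refl
Σℚ-const (_ ∷ xs) q = cong (q ℚ.+_) (Σℚ-const xs q)

Σℚ-· : ∀ (k : A → ℕ) xs q → Σℚ (λ x → k x · q) xs ≡ sum (map k xs) · q
Σℚ-· k []       q = refl
Σℚ-· k (x ∷ xs) q =
  trans (cong (k x · q ℚ.+_) (Σℚ-· k xs q)) (sym (×-homo-+ q (k x) (sum (map k xs))))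

·-Σℚ : ∀ k (f : A → ℚ) xs → Σℚ (λ x → k · f x) xs ≡ k · Σℚ f xs
·-Σℚ zero f []       = refl
·-Σℚ zero f (_ ∷ xs) = trans (ℚ.+-identityˡ _) (·-Σℚ zero f xs)
·-Σℚ (suc k) f xs = trans (Σℚ-+ xs) (cong (Σℚ f xs ℚ.+_) (·-Σℚ k f xs))
  where
  open +-*-Solver
  Σℚ-+ : ∀ xs → Σℚ (λ x → f x ℚ.+ k · f x) xs ≡ Σℚ f xs ℚ.+ Σℚ (λ x → k · f x) xs
  Σℚ-+ []       = refl
  Σℚ-+ (x ∷ xs) = trans (cong (f x ℚ.+ k · f x ℚ.+_) (Σℚ-+ xs))
    (solve 4 (λ a b c d → (a :+ b) :+ (c :+ d) := (a :+ c) :+ (b :+ d)) refl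
      (f x) (k · f x) (Σℚ f xs) (Σℚ (λ x → k · f x) xs))

·-nonNeg : ∀ k {q} → 0ℚ ℚ.≤ q → 0ℚ ℚ.≤ k · q
·-nonNeg zero    0≤q = ℚ.≤-refl
·-nonNeg (suc k) 0≤q = ℚ.+-mono-≤ 0≤q (·-nonNeg k 0≤q)

·-monoˡ : ∀ {k l} → k ℕ.≤ l → ∀ {q} → 0ℚ ℚ.≤ q → k · q ℚ.≤ l · q
·-monoˡ {l = l} z≤n       0≤q = ·-nonNeg l 0≤q
·-monoˡ         (s≤s k≤l) {q} 0≤q = ℚ.+-monoʳ-≤ q (·-monoˡ k≤l 0≤q)

·-*ʳ : ∀ k p q → (k · p) ℚ.* q ≡ k · (p ℚ.* q)
·-*ʳ zero    p q = ℚ.*-zeroˡ q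
·-*ʳ (suc k) p q = trans (ℚ.*-distribʳ-+ q p (k · p)) (cong (p ℚ.* q ℚ.+_) (·-*ʳ k p q))

-- Double counting of related pairs, applied to vertices against edges and to edges against trees.
Σℚ-filter-swap : {R : REL A B 0ℓ} (R? : Decidable R) (f : A → B → ℚ) (xs : List A) (ys : List B) →
  Σℚ (λ x → Σℚ (f x) (filter (R? x) ys)) xs ≡
  Σℚ (λ y → Σℚ (λ x → f x y) (filter (λ x → R? x y) xs)) ys
Σℚ-filter-swap R? f []       []       = refl
Σℚ-filter-swap R? f []       (_ ∷ ys) =
  trans (Σℚ-filter-swap R? f [] ys) (sym (ℚ.+-identityˡ _))
Σℚ-filter-swap {A = A} {B = B} R? f (x ∷ xs) ys =
  trans (cong (Σℚ (f x) (filter (R? x) ys) ℚ.+_) (Σℚ-filter-swap R? f xs ys)) (split ys)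
  where
  open +-*-Solver
  g h : B → ℚ
  g y = Σℚ (λ x → f x y) (filter (λ x → R? x y) xs)
  h y = Σℚ (λ x → f x y) (filter (λ x → R? x y) (x ∷ xs))
  split : ∀ ys → Σℚ (f x) (filter (R? x) ys) ℚ.+ Σℚ g ys ≡ Σℚ h ys
  split []       = refl
  split (y ∷ ys) with R? x y
  ... | yes _ = trans
    (solve 4 (λ a b c d → (a :+ b) :+ (c :+ d) := (a :+ c) :+ (b :+ d)) refl
      (f x y) (Σℚ (f x) (filter (R? x) ys)) (g y) (Σℚ g ys))
    (cong (f x y ℚ.+ g y ℚ.+_) (split ys))
  ... | no  _ = trans
    (solve 3 (λ a b c → a :+ (b :+ c) := b :+ (a :+ c)) refl
      (Σℚ (f x) (filter (R? x) ys)) (g y) (Σℚ g ys))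
    (cong (g y ℚ.+_) (split ys))

-- Averaging over spanning trees

Eventually : (ℕ → Set) → Set
Eventually P = ∃[ N ] (∀ n → N ℕ.≤ n → P n)

eventually-All : {P : A → ℕ → Set} → (∀ x → Eventually (P x)) →
                 ∀ xs → Eventually (λ n → All (λ x → P x n) xs)
eventually-All ev []       = 0 , λ _ _ → []
eventually-All ev (x ∷ xs) =
  let M , p = ev x
      N , q = eventually-All ev xs
  in  M ℕ.⊔ N , λ n ≤n → p n (ℕ.m⊔n≤o⇒m≤o M N ≤n) ∷ q n (ℕ.m⊔n≤o⇒n≤o M N ≤n)

module _ (G : Graph) (conn : Connected G) where
  open Graph G

  -- Repetitions in `vs` encode natural vertex weights. The ends of an edge differ, so this is the
  -- sum of their weights, and `degreeSum` is the weighted degree sum in `T`.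
  multiplicity : List Vertex → Edge G → ℕ
  multiplicity vs e = length (filter (λ v → incident? G v e) vs)

  degreeSum : List Vertex → Subset (size G) → ℕ
  degreeSum vs T = sum (map (multiplicity vs) (chosen T))

  -- Exchanging vertices with edges, then edges with trees, collects the contributions of each tree.
  -- With tree weights for `W` this is the expected weighted degree sum before normalisation.
  degreeSum-weighted : ∀ vs (W : Subset (size G) → ℚ) Ts →
    Σℚ (λ v → Σℚ (λ e → Σℚ W (filter (e Subset.∈?_) Ts))
                 (filter (incident? G v) (allFin (size G)))) vs ≡
    Σℚ (λ T → degreeSum vs T · W T) Ts
  degreeSum-weighted vs W Ts = begin
    Σℚ (λ v → Σℚ g (filter (incident? G v) E)) vs
      ≡⟨ Σℚ-filter-swap (incident? G) (λ _ → g) vs E ⟩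
    Σℚ (λ e → Σℚ (λ _ → g e) (filter (λ v → incident? G v e) vs)) E
      ≡⟨ Σℚ-cong E (λ e → trans (Σℚ-const (filter (λ v → incident? G v e) vs) (g e))
           (sym (·-Σℚ (multiplicity vs e) W (filter (e Subset.∈?_) Ts)))) ⟩
    Σℚ (λ e → Σℚ (λ T → multiplicity vs e · W T) (filter (e Subset.∈?_) Ts)) E
      ≡⟨ Σℚ-filter-swap Subset._∈?_ (λ e T → multiplicity vs e · W T) E Ts ⟩
    Σℚ (λ T → Σℚ (λ e → multiplicity vs e · W T) (chosen T)) Ts
      ≡⟨ Σℚ-cong Ts (λ T → Σℚ-· (multiplicity vs) (chosen T) (W T)) ⟩
    Σℚ (λ T → degreeSum vs T · W T) Ts ∎
    where
    open ≡-Reasoning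
    E = allFin (size G)
    g : Edge G → ℚ
    g e = Σℚ W (filter (e Subset.∈?_) Ts)

  -- Averaged over the random spanning tree of a nonnegatively curved
  -- weighting, no vertex has degree above 2.
  ¬resistanceNonnegative : ∀ vs →
    (∀ T → IsSpanningTree G T → 2 ℕ.* length vs ℕ.< degreeSum vs T) →
    ¬ ResistanceNonnegative G conn
  ¬resistanceNonnegative vs large (c , nonneg) = ℚ.<-irrefl refl (ℚ.<-≤-trans upper lower)
    where
    open ℚ.≤-Reasoning
    L = length vs
    K = suc (2 ℕ.* L)
    Ts = spanningTrees G

    0<K·1 : 0ℚ ℚ.< K · 1ℚ
    0<K·1 = ℚ.+-mono-<-≤ 0<1 (·-nonNeg (2 ℕ.* L) (ℚ.<⇒≤ 0<1))

    -- Each curvature may fall short of 0 by `δ`. Over all of `vs` this costs `(2 * L) · δ`, less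
    -- than `K · δ = 1`, which is the gap between `2 * L` and the least admissible degree sum `K`.
    δ = invℚ (K · 1ℚ)
    y = 1ℚ ℚ.+ δ

    0<δ : 0ℚ ℚ.< δ
    0<δ = invℚ-pos 0<K·1

    K·δ≡1 : K · δ ≡ 1ℚ
    K·δ≡1 = trans (cong (K ·_) (sym (ℚ.*-identityˡ δ)))
      (trans (sym (·-*ʳ K 1ℚ δ)) (invℚ-inverseʳ 0<K·1))

    Z-eventually = treeSum-pos G conn c

    W-eventually : Eventually (λ n → All (λ T → 0ℚ ℚ.≤ seq (treeWeight G conn c T) n) Ts)
    W-eventually = eventually-All (λ T →
      let p = ∏-pos (proj₁ c) (proj₂ c) (chosen T)
      in  proj₁ (proj₂ (proj₂ p)) , λ n ≤n →
            ℚ.≤-trans (ℚ.<⇒≤ (proj₁ (proj₂ p)))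
              (eventually-≥ (treeWeight G conn c T) p n ≤n)) Ts

    curvature-eventually :
      Eventually (λ n → All (λ v → 0ℚ ℚ.≤ seq (curvature G conn c v) n ℚ.+ δ) vs)
    curvature-eventually = eventually-All (λ v → nonneg v δ 0<δ) vs

    N₁ = proj₁ (proj₂ (proj₂ Z-eventually))
    N₂ = proj₁ W-eventually
    N₃ = proj₁ curvature-eventually
    -- At this index the tree sum is positive, the tree weights are nonnegative and the curvatures
    -- on `vs` are at least `-δ`.
    n  = N₁ ℕ.⊔ (N₂ ℕ.⊔ N₃)

    W : Subset (size G) → ℚ
    W T = seq (treeWeight G conn c T) n

    Z = seq (treeSum G conn c) n

    0<Z : 0ℚ ℚ.< Z
    0<Z = ℚ.<-≤-trans (proj₁ (proj₂ Z-eventually))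
      (eventually-≥ (treeSum G conn c) Z-eventually n (ℕ.m≤m⊔n N₁ (N₂ ℕ.⊔ N₃)))

    0≤W : All (λ T → 0ℚ ℚ.≤ W T) Ts
    0≤W = proj₂ W-eventually n (ℕ.≤-trans (ℕ.m≤m⊔n N₂ N₃) (ℕ.m≤n⊔m N₁ (N₂ ℕ.⊔ N₃)))

    incident : Vertex → List (Edge G)
    incident v = filter (incident? G v) (allFin (size G))

    r : Vertex → ℚ
    r v = seq (∑ (map (relativeResistance G conn c) (incident v))) n

    r≡ : ∀ v → r v ≡ Σℚ (λ e → Σℚ W (filter (e Subset.∈?_) Ts)) (incident v) ℚ.* invℚ Z
    r≡ v = trans (seq-∑ (relativeResistance G conn c) (incident v) n)
      (trans (Σℚ-cong (incident v) λ e → cong (ℚ._* invℚ Z)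
               (seq-∑ (treeWeight G conn c) (filter (e Subset.∈?_) Ts) n))
        (sym (Σℚ-*ʳ (λ e → Σℚ W (filter (e Subset.∈?_) Ts)) (incident v) (invℚ Z))))

    r≤ : ∀ {v} → 0ℚ ℚ.≤ seq (curvature G conn c v) n ℚ.+ δ → r v ℚ.≤ 2 · y
    r≤ {v} 0≤ = begin
      r v              ≡⟨ ℚ.+-identityʳ (r v) ⟨
      -- Adding the curvature bound twice cancels `r v`, which enters the curvature with factor one
      -- half.
      r v ℚ.+ 2 · 0ℚ   ≤⟨ ℚ.+-monoʳ-≤ (r v) (ℚ.+-mono-≤ 0≤ (ℚ.+-monoˡ-≤ 0ℚ 0≤)) ⟩
      r v ℚ.+ 2 · (1ℚ ℚ.- ½ ℚ.* r v ℚ.+ δ)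
        ≡⟨ solve 2 (λ r δ →
             r :+ ((con 1ℚ :- con ½ :* r :+ δ) :+ ((con 1ℚ :- con ½ :* r :+ δ) :+ con 0ℚ))
             := (con 1ℚ :+ δ) :+ ((con 1ℚ :+ δ) :+ con 0ℚ)) refl (r v) δ ⟩
      2 · y            ∎
      where open +-*-Solver

    -- After division by the total tree weight `Z`, the right side is an average of degree sums,
    -- each at least `K`.
    lower : K · 1ℚ ℚ.≤ Σℚ r vs
    lower = begin
      K · 1ℚ                     ≡⟨ cong (K ·_) (invℚ-inverseʳ 0<Z) ⟨
      K · (Z ℚ.* invℚ Z)         ≡⟨ ·-*ʳ K Z (invℚ Z) ⟨
      (K · Z) ℚ.* invℚ Z
        ≡⟨ cong (λ z → (K · z) ℚ.* invℚ Z) (seq-∑ (treeWeight G conn c) Ts n) ⟩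
      (K · Σℚ W Ts) ℚ.* invℚ Z   ≡⟨ cong (ℚ._* invℚ Z) (·-Σℚ K W Ts) ⟨
      Σℚ (λ T → K · W T) Ts ℚ.* invℚ Z
        ≤⟨ ℚ.*-monoʳ-≤-nonNeg (invℚ Z) {{ℚ.nonNegative (ℚ.<⇒≤ (invℚ-pos 0<Z))}}
             (Σℚ-mono (All.tabulate λ {T} T∈ → ·-monoˡ
               (large T (proj₂ (∈-filter⁻ (λ T → isTree? (spanningSubgraph G T))
                                          {xs = subsets (size G)} T∈)))
               (All.lookup 0≤W T∈))) ⟩
      Σℚ (λ T → degreeSum vs T · W T) Ts ℚ.* invℚ Z
        ≡⟨ cong (ℚ._* invℚ Z) (degreeSum-weighted vs W Ts) ⟨
      Σℚ (λ v → Σℚ (λ e → Σℚ W (filter (e Subset.∈?_) Ts)) (incident v)) vs ℚ.* invℚ Z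
        ≡⟨ Σℚ-*ʳ (λ v → Σℚ (λ e → Σℚ W (filter (e Subset.∈?_) Ts)) (incident v)) vs (invℚ Z) ⟩
      Σℚ (λ v → Σℚ (λ e → Σℚ W (filter (e Subset.∈?_) Ts)) (incident v) ℚ.* invℚ Z) vs
        ≡⟨ Σℚ-cong vs r≡ ⟨
      Σℚ r vs ∎

    upper : Σℚ r vs ℚ.< K · 1ℚ
    upper = begin-strict
      Σℚ r vs                  ≤⟨ Σℚ-mono (All.map r≤ (proj₂ curvature-eventually n
                                    (ℕ.≤-trans (ℕ.m≤n⊔m N₂ N₃) (ℕ.m≤n⊔m N₁ (N₂ ℕ.⊔ N₃))))) ⟩
      Σℚ (λ _ → 2 · y) vs      ≡⟨ Σℚ-const vs (2 · y) ⟩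
      L · (2 · y)              ≡⟨ ×-assocˡ y L 2 ⟩
      (L ℕ.* 2) · y            ≡⟨ cong (_· y) (ℕ.*-comm L 2) ⟩
      (2 ℕ.* L) · y            ≡⟨ ×-distrib-+ 1ℚ δ (2 ℕ.* L) ⟩
      (2 ℕ.* L) · 1ℚ ℚ.+ (2 ℕ.* L) · δ
        <⟨ ℚ.+-monoʳ-< ((2 ℕ.* L) · 1ℚ) (ℚ.≤-<-trans
             (ℚ.≤-reflexive (sym (ℚ.+-identityˡ ((2 ℕ.* L) · δ))))
             (ℚ.+-monoˡ-< ((2 ℕ.* L) · δ) 0<δ)) ⟩
      (2 ℕ.* L) · 1ℚ ℚ.+ K · δ ≡⟨ cong ((2 ℕ.* L) · 1ℚ ℚ.+_) K·δ≡1 ⟩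
      (2 ℕ.* L) · 1ℚ ℚ.+ 1ℚ    ≡⟨ ℚ.+-comm ((2 ℕ.* L) · 1ℚ) 1ℚ ⟩
      K · 1ℚ                   ∎

-- Counting entries of lists

filter-nonempty : {P : A → Set} (P? : Unary.Decidable P) {x : A} {xs : List A} →
                  x ∈ xs → P x → 1 ℕ.≤ length (filter P? xs)
filter-nonempty P? x∈ px = unique-⊆⇒length≤ ([] ∷ []) λ { (here refl) → ∈-filter⁺ P? x∈ px }

filter-two : {P : A → Set} (P? : Unary.Decidable P) {x y : A} {xs : List A} → x ≢ y →
             x ∈ xs → P x → y ∈ xs → P y → 2 ℕ.≤ length (filter P? xs)
filter-two P? x≢y x∈ px y∈ py = unique-⊆⇒length≤ ((x≢y ∷ []) ∷ [] ∷ [])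
  λ { (here refl) → ∈-filter⁺ P? x∈ px ; (there (here refl)) → ∈-filter⁺ P? y∈ py }

unique⇒length≤∣∣ : ∀ {n} {X : Subset n} {xs} → Unique xs → All (Subset._∈ X) xs →
                   length xs ℕ.≤ ∣ X ∣
unique⇒length≤∣∣ []         _          = z≤n
unique⇒length≤∣∣ (x∉ ∷ uniq) (x∈X ∷ xs⊆X) = ℕ.<-≤-trans
  (s≤s (unique⇒length≤∣∣ uniq (All.zipWith
    (λ (x≢y , y∈X) → Subset.x∈p∧x≢y⇒x∈p-y y∈X (x≢y ∘ sym)) (x∉ , xs⊆X))))
  (Subset.x∈p⇒∣p-x∣<∣p∣ x∈X)

-- An exceptional term falls short of 2 by at most 1, and its entry in the filtered list makes up
-- for that.
2*length≤sum+exceptions : (f : A → ℕ) {E : A → Set} (E? : Unary.Decidable E) →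
  (∀ x → 2 ℕ.≤ f x ⊎ (1 ℕ.≤ f x × E x)) →
  ∀ xs → 2 ℕ.* length xs ℕ.≤ sum (map f xs) ℕ.+ length (filter E? xs)
2*length≤sum+exceptions f E? h [] = z≤n
2*length≤sum+exceptions f E? h (x ∷ xs) with E? x | h x | 2*length≤sum+exceptions f E? h xs
... | no  _  | inj₁ 2≤ | ih = begin
  2 ℕ.* suc (length xs) ≡⟨ ℕ.*-suc 2 (length xs) ⟩
  2 ℕ.+ 2 ℕ.* length xs ≤⟨ ℕ.+-mono-≤ 2≤ ih ⟩
  f x ℕ.+ (sum (map f xs) ℕ.+ length (filter E? xs)) ≡⟨ ℕ.+-assoc (f x) _ _ ⟨
  f x ℕ.+ sum (map f xs) ℕ.+ length (filter E? xs) ∎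
  where open ℕ.≤-Reasoning
... | no  ¬e | inj₂ (_ , e) | _ = contradiction e ¬e
... | yes _  | hx | ih = begin
  2 ℕ.* suc (length xs) ≡⟨ ℕ.*-suc 2 (length xs) ⟩
  1 ℕ.+ (1 ℕ.+ 2 ℕ.* length xs) ≤⟨ ℕ.+-mono-≤ (1≤ hx) (s≤s ih) ⟩
  f x ℕ.+ suc (sum (map f xs) ℕ.+ length (filter E? xs)) ≡⟨ cong (f x ℕ.+_) (ℕ.+-suc _ _) ⟨
  f x ℕ.+ (sum (map f xs) ℕ.+ suc (length (filter E? xs))) ≡⟨ ℕ.+-assoc (f x) _ _ ⟨
  f x ℕ.+ sum (map f xs) ℕ.+ suc (length (filter E? xs)) ∎
  where
  open ℕ.≤-Reasoning
  1≤ : 2 ℕ.≤ f x ⊎ (1 ℕ.≤ f x × _) → 1 ℕ.≤ f x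
  1≤ (inj₁ 2≤)       = ℕ.<⇒≤ 2≤
  1≤ (inj₂ (1≤fx , _)) = 1≤fx

-- Edges and components of a graph

module _ (G : Graph) where
  open Graph G

  ends-adjacent : ∀ e → proj₁ (ends G e) ∼ proj₂ (ends G e)
  ends-adjacent e = proj₂ (proj₂
    (∈-filter⁻ (isEdge? G) {xs = cartesianProduct (allFin order) (allFin order)}
      (∈-lookup {xs = edges G} e)))

  joins⇒incident : ∀ e {u v} → Joins G e u v → Incident G u e
  joins⇒incident e (inj₁ p) = inj₁ (sym (cong proj₁ p))
  joins⇒incident e (inj₂ p) = inj₂ (sym (cong proj₂ p))

  -- `edges` has no repetitions and puts the smaller end first, so opposite orientations would give
  -- both `u < v` and `v < u`.
  joins-functional : ∀ e e′ {u v} → Joins G e u v → Joins G e′ u v → e ≡ e′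
  joins-functional e e′ {u} {v} j j′ = lookup-injective
    (Unique.filter⁺ (isEdge? G)
      (Unique.cartesianProduct⁺ (Unique.allFin⁺ order) (Unique.allFin⁺ order)))
    e e′ (same j j′)
    where
    ordered : ∀ e {u v} → ends G e ≡ (u , v) → u Fin.< v
    ordered e p = subst (λ f → proj₁ f Fin.< proj₂ f) p (ends-edge G e)
    same : Joins G e u v → Joins G e′ u v → ends G e ≡ ends G e′
    same (inj₁ p) (inj₁ q) = trans p (sym q)
    same (inj₁ p) (inj₂ q) = contradiction (ordered e′ q) (Fin.<-asym (ordered e p))
    same (inj₂ p) (inj₁ q) = contradiction (ordered e p) (Fin.<-asym (ordered e′ q))
    same (inj₂ p) (inj₂ q) = trans p (sym q)

  -- Components are Boolean vectors of decided reachability, so it suffices that walks from `u` and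
  -- from `v` convert into each other by prefixing `uv` or its reverse.
  component-cong : ∀ X {u v} → Star (Avoiding G X) u v → component G X u ≡ component G X v
  component-cong X {u} {v} uv = Vec.tabulate-cong λ w → does-⇔
    (mk⇔ (reverse (λ (a , b , r) → b , a , ∼-sym r) uv ◅◅_) (uv ◅◅_))
    (star? (avoiding? G X) u w) (star? (avoiding? G X) v w)

  -- `components` is free of duplicates, so any list `ys` of candidates covering it bounds its
  -- length.
  c[G-]≤ : ∀ X ys → (∀ u → u Subset.∉ X → component G X u ∈ ys) → c[G-_] G X ℕ.≤ length ys
  c[G-]≤ X ys h = unique-⊆⇒length≤ (DecUnique.deduplicate-! ≟ comps)
    λ z∈ → ⊆ys (∈-deduplicate⁻ ≟ comps z∈)
    where
    ≟ = Vec.≡-dec Bool._≟_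
    outside? = λ u → ¬? (u Subset.∈? X)
    comps = map (component G X) (filter outside? (allFin order))
    ⊆ys : comps ⊆ ys
    ⊆ys z∈ with ∈-map⁻ (component G X) z∈
    ... | u , u∈ , refl = h u (proj₂ (∈-filter⁻ outside? {xs = allFin order} u∈))

-- The hub–core–leaf graph

module HubCoreLeaf (s m : ℕ) where

  Kind : Set
  Kind = Fin s ⊎ (Fin m ⊎ Fin m)

  pattern hub i  = inj₁ i
  pattern core i = inj₂ (inj₁ i)
  pattern leaf i = inj₂ (inj₂ i)

  n : ℕ
  n = s ℕ.+ (m ℕ.+ m)

  kind : Fin n → Kind
  kind v = Sum.map₂ (splitAt m) (splitAt s v)

  vertex : Kind → Fin n
  vertex k = join s (m ℕ.+ m) (Sum.map₂ (join m m) k)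

  kind-vertex : ∀ k → kind (vertex k) ≡ k
  kind-vertex k = trans
    (cong (Sum.map₂ (splitAt m)) (Fin.splitAt-join s (m ℕ.+ m) (Sum.map₂ (join m m) k))) (eq k)
    where
    eq : ∀ k → Sum.map₂ (splitAt m) (Sum.map₂ (join m m) k) ≡ k
    eq (inj₁ _) = refl
    eq (inj₂ k) = cong inj₂ (Fin.splitAt-join m m k)

  vertex-kind : ∀ v → vertex (kind v) ≡ v
  vertex-kind v = trans
    (cong (join s (m ℕ.+ m)) (eq (splitAt s v))) (Fin.join-splitAt s (m ℕ.+ m) v)
    where
    eq : ∀ w → Sum.map₂ (join m m) (Sum.map₂ (splitAt m) w) ≡ w
    eq (inj₁ _) = refl
    eq (inj₂ w) = cong inj₂ (Fin.join-splitAt m m w)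

  vertex-injective : ∀ {k l} → vertex k ≡ vertex l → k ≡ l
  vertex-injective {k} {l} eq = trans (sym (kind-vertex k)) (trans (cong kind eq) (kind-vertex l))

  -- Adjacent or equal, except that a leaf is not near itself.
  Near : Rel Kind 0ℓ
  Near (hub _)  _        = ⊤
  Near (core _) (hub _)  = ⊤
  Near (core _) (core _) = ⊤
  Near (core i) (leaf j) = i ≡ j
  Near (leaf _) (hub _)  = ⊤
  Near (leaf i) (core j) = i ≡ j
  Near (leaf _) (leaf _) = ⊥

  near? : Decidable Near
  near? (hub _)  _        = yes tt
  near? (core _) (hub _)  = yes tt
  near? (core _) (core _) = yes tt
  near? (core i) (leaf j) = i Fin.≟ j
  near? (leaf _) (hub _)  = yes tt
  near? (leaf i) (core j) = i Fin.≟ j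
  near? (leaf _) (leaf _) = no id

  near-hub : ∀ k {i} → Near k (hub i)
  near-hub (hub _)  = tt
  near-hub (core _) = tt
  near-hub (leaf _) = tt

  near-sym : ∀ k l → Near k l → Near l k
  near-sym (hub _)  l        _  = near-hub l
  near-sym (core _) (hub _)  _  = tt
  near-sym (core _) (core _) _  = tt
  near-sym (core _) (leaf _) eq = sym eq
  near-sym (leaf _) (hub _)  _  = tt
  near-sym (leaf _) (core _) eq = sym eq

  G : Graph
  G = record
    { order    = n
    ; _∼_      = λ u v → u ≢ v × Near (kind u) (kind v)
    ; _∼?_     = λ u v → ¬? (u Fin.≟ v) ×-dec near? (kind u) (kind v)
    ; ∼-sym    = λ {u} {v} (u≢v , near) → u≢v ∘ sym , near-sym (kind u) (kind v) near
    ; ∼-irrefl = λ eq (u≢v , _) → u≢v eq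
    }

  open Graph G using (_∼_)

  adjacent : ∀ {k l} → vertex k ≢ vertex l → Near k l → vertex k ∼ vertex l
  adjacent {k} {l} k≢l near = k≢l , subst₂ Near (sym (kind-vertex k)) (sym (kind-vertex l)) near

  -- Near vertices may coincide, and then the empty walk serves; callers never have to compare two
  -- hubs or two cores. `embed` carries the edge into `R`, either adjacency itself or adjacency
  -- avoiding a cut.
  near⇒star : ∀ {R : Rel (Fin n) 0ℓ} k l → (vertex k ∼ vertex l → R (vertex k) (vertex l)) →
              Near k l → Star R (vertex k) (vertex l)
  near⇒star {R} k l embed near with vertex k Fin.≟ vertex l
  ... | yes eq = subst (Star R (vertex k)) eq done
  ... | no  ne = embed (adjacent ne near) ◅ done

  connected : Fin s → Connected G
  connected i = ℕ.≤-<-trans z≤n (Fin.toℕ<n (vertex (hub i))) , λ u v →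
    subst₂ (Star _∼_) (vertex-kind u) (vertex-kind v)
      (near⇒star (kind u) (hub i) id (near-hub (kind u)) ◅◅ near⇒star (hub i) (kind v) id tt)

  -- Vertex weights and the degree count

  hubs cores : List (Fin n)
  hubs  = map (vertex ∘ hub) (allFin s)
  cores = map (vertex ∘ core) (allFin m)

  ∈-hubs : ∀ i → vertex (hub i) ∈ hubs
  ∈-hubs i = ∈-map⁺ (vertex ∘ hub) (∈-allFin i)

  ∈-cores : ∀ i → vertex (core i) ∈ cores
  ∈-cores i = ∈-map⁺ (vertex ∘ core) (∈-allFin i)

  -- The vertex weights 2, 1, 0 of hubs, cores and leaves, as multiplicities.
  doubledHubs : List (Fin n)
  doubledHubs = hubs ++ (hubs ++ cores)

  length-doubledHubs : length doubledHubs ≡ s ℕ.+ (s ℕ.+ m)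
  length-doubledHubs = trans (List.length-++ hubs)
    (cong₂ ℕ._+_ (len (vertex ∘ hub)) (trans (List.length-++ hubs)
      (cong₂ ℕ._+_ (len (vertex ∘ hub)) (len (vertex ∘ core)))))
    where
    len : ∀ {k} (f : Fin k → Fin n) → length (map f (allFin k)) ≡ k
    len f = trans (List.length-map f (allFin _)) (List.length-tabulate id)

  -- The core-leaf edges, with end weights summing to 1. They are pendant once the hubs are deleted.
  Pendant : Edge G → Set
  Pendant e = ∃[ i ] Joins G e (vertex (core i)) (vertex (leaf i))

  pendant? : ∀ e → Dec (Pendant e)
  pendant? e = Fin.any? λ i → joins? G e (vertex (core i)) (vertex (leaf i))

  module _ (conn : Connected G) where

    mult : Edge G → ℕ
    mult = multiplicity G conn doubledHubs

    -- A hub is counted in both copies of `hubs`, and two adjacent cores are distinct entries of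
    -- `cores`. Leaves are never near each other, so only core-leaf edges remain.
    multiplicity-bound : ∀ e → 2 ℕ.≤ mult e ⊎ (1 ℕ.≤ mult e × Pendant e)
    multiplicity-bound e = classify (kind p) (kind q)
      (subst₂ (Joins G e) (sym (vertex-kind p)) (sym (vertex-kind q)) (inj₁ refl))
      (proj₁ (ends-adjacent G e) ∘ λ eq → trans (sym (vertex-kind p)) (trans eq (vertex-kind q)))
      (proj₂ (ends-adjacent G e))
      where
      p = proj₁ (ends G e)
      q = proj₂ (ends G e)
      inc? = λ v → incident? G v e
      mult≡ : mult e ≡ length (filter inc? hubs) ℕ.+ length (filter inc? (hubs ++ cores))
      mult≡ = trans (cong length (List.filter-++ inc? hubs (hubs ++ cores)))
        (List.length-++ (filter inc? hubs))
      withHub : ∀ i → Incident G (vertex (hub i)) e → 2 ℕ.≤ mult e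
      withHub i inc = subst (2 ℕ.≤_) (sym mult≡) (ℕ.+-mono-≤
        (filter-nonempty inc? (∈-hubs i) inc)
        (filter-nonempty inc? (∈-++⁺ˡ (∈-hubs i)) inc))
      ≤mult : ∀ {k} → k ℕ.≤ length (filter inc? (hubs ++ cores)) → k ℕ.≤ mult e
      ≤mult k≤ = subst (_ ℕ.≤_) (sym mult≡) (ℕ.≤-trans k≤ (ℕ.m≤n+m _ _))
      classify : ∀ k l → Joins G e (vertex k) (vertex l) → vertex k ≢ vertex l → Near k l →
                 2 ℕ.≤ mult e ⊎ (1 ℕ.≤ mult e × Pendant e)
      classify (hub i)  _        j _ _ = inj₁ (withHub i (joins⇒incident G e j))
      classify (core _) (hub i)  j _ _ = inj₁ (withHub i (joins⇒incident G e (Sum.swap j)))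
      classify (leaf _) (hub i)  j _ _ = inj₁ (withHub i (joins⇒incident G e (Sum.swap j)))
      classify (core i) (core k) j i≢k _ = inj₁ (≤mult (filter-two inc? i≢k
        (∈-++⁺ʳ hubs (∈-cores i)) (joins⇒incident G e j)
        (∈-++⁺ʳ hubs (∈-cores k)) (joins⇒incident G e (Sum.swap j))))
      classify (core i) (leaf .i) j _ refl = inj₂ (≤mult
        (filter-nonempty inc? (∈-++⁺ʳ hubs (∈-cores i)) (joins⇒incident G e j)) , i , j)
      classify (leaf i) (core .i) j _ refl = inj₂ (≤mult
        (filter-nonempty inc? (∈-++⁺ʳ hubs (∈-cores i)) (joins⇒incident G e (Sum.swap j)))
        , i , Sum.swap j)

    -- The index of the core determines the edge, so the edges `pendant i` include every pendant
    -- edge of `T`.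
    pendant-count : ∀ T → length (filter pendant? (chosen T)) ℕ.≤ m
    pendant-count T = subst (length (filter pendant? (chosen T)) ℕ.≤_)
      (trans (List.length-map (proj₁ ∘ pendant) (allFin m)) (List.length-tabulate id))
      (unique-⊆⇒length≤
        (Unique.filter⁺ pendant? (Unique.filter⁺ (Subset._∈? T) (Unique.allFin⁺ _))) ⊆pendants)
      where
      pendant : ∀ i → ∃[ e ] Joins G e (vertex (core i)) (vertex (leaf i))
      pendant i = edge-of G
        (adjacent {core i} {leaf i} ((λ ()) ∘ vertex-injective {core i} {leaf i}) refl)
      ⊆pendants : filter pendant? (chosen T) ⊆ map (proj₁ ∘ pendant) (allFin m)
      ⊆pendants {e} e∈ with proj₂ (∈-filter⁻ pendant? {xs = chosen T} e∈)
      ... | i , j = subst (_∈ map (proj₁ ∘ pendant) (allFin m))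
        (sym (joins-functional G e (proj₁ (pendant i)) j (proj₂ (pendant i))))
        (∈-map⁺ (proj₁ ∘ pendant) (∈-allFin i))

    -- At least `n - 1` edges, each worth 2, with a total deficit of at most `m`; written additively
    -- to avoid truncated subtraction.
    degreeSum-bound : ∀ T → IsSpanningTree G T →
      2 ℕ.* n ℕ.≤ 2 ℕ.+ (degreeSum G conn doubledHubs T ℕ.+ m)
    degreeSum-bound T (connT , _) = begin
      2 ℕ.* n                        ≤⟨ ℕ.*-monoʳ-≤ 2 (order≤1+edges G T connT) ⟩
      2 ℕ.* suc (length (chosen T))  ≡⟨ ℕ.*-suc 2 (length (chosen T)) ⟩
      2 ℕ.+ 2 ℕ.* length (chosen T)
        ≤⟨ ℕ.+-monoʳ-≤ 2 (2*length≤sum+exceptions mult pendant? multiplicity-bound (chosen T)) ⟩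
      2 ℕ.+ (degreeSum G conn doubledHubs T ℕ.+ length (filter pendant? (chosen T)))
        ≤⟨ ℕ.+-monoʳ-≤ 2 (ℕ.+-monoʳ-≤ (degreeSum G conn doubledHubs T) (pendant-count T)) ⟩
      2 ℕ.+ (degreeSum G conn doubledHubs T ℕ.+ m) ∎
      where open ℕ.≤-Reasoning

    ¬RN : m ≡ 2 ℕ.* s ℕ.+ 3 → ¬ ResistanceNonnegative G conn
    ¬RN m≡ = ¬resistanceNonnegative G conn doubledHubs λ T t →
      -- With `2 + m` added, the left side equals `2 * n` exactly when `m = 2 * s + 3`, the least
      -- `m` for which this bound suffices.
      ℕ.+-cancelʳ-≤ (2 ℕ.+ m) _ _ (begin
        suc (2 ℕ.* length doubledHubs) ℕ.+ (2 ℕ.+ m)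
          ≡⟨ cong (λ l → suc (2 ℕ.* l) ℕ.+ (2 ℕ.+ m)) length-doubledHubs ⟩
        suc (2 ℕ.* (s ℕ.+ (s ℕ.+ m))) ℕ.+ (2 ℕ.+ m)
          ≡⟨ subst (λ m → suc (2 ℕ.* (s ℕ.+ (s ℕ.+ m))) ℕ.+ (2 ℕ.+ m) ≡ 2 ℕ.* (s ℕ.+ (m ℕ.+ m)))
               (sym m≡) (eq s) ⟩
        2 ℕ.* n  ≤⟨ degreeSum-bound T t ⟩
        2 ℕ.+ (degreeSum G conn doubledHubs T ℕ.+ m) ≡⟨ eq′ (degreeSum G conn doubledHubs T) m ⟩
        degreeSum G conn doubledHubs T ℕ.+ (2 ℕ.+ m) ∎)
      where
      open ℕ.≤-Reasoning
      eq : ∀ s → suc (2 ℕ.* (s ℕ.+ (s ℕ.+ (2 ℕ.* s ℕ.+ 3)))) ℕ.+ (2 ℕ.+ (2 ℕ.* s ℕ.+ 3)) ≡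
                 2 ℕ.* (s ℕ.+ ((2 ℕ.* s ℕ.+ 3) ℕ.+ (2 ℕ.* s ℕ.+ 3)))
      eq = solve-∀
      eq′ : ∀ d m → 2 ℕ.+ (d ℕ.+ m) ≡ d ℕ.+ (2 ℕ.+ m)
      eq′ = solve-∀

  -- Sets whose removal disconnects the graph

  module _ (X : Subset n) (1<c : 1 ℕ.< c[G-_] G X) where

    -- A surviving hub would reach every surviving vertex, leaving a single component.
    hubs⊆ : ∀ i → vertex (hub i) Subset.∈ X
    hubs⊆ i with vertex (hub i) Subset.∈? X
    ... | yes i∈ = i∈
    ... | no  i∉ = contradiction 1<c (ℕ.≤⇒≯
      (c[G-]≤ G X (component G X (vertex (hub i)) ∷ []) λ u u∉ →
      here (sym (component-cong G X (subst (Star (Avoiding G X) (vertex (hub i))) (vertex-kind u)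
        (near⇒star (hub i) (kind u)
          (λ r → i∉ , subst (Subset._∉ X) (sym (vertex-kind u)) u∉ , r) tt))))))

    cut? : ∀ i → Dec (vertex (core i) Subset.∈ X)
    cut? i = vertex (core i) Subset.∈? X

    cutCores : List (Fin m)
    cutCores = filter cut? (allFin m)

    -- The surviving cores form a clique, so they and the surviving leaves attached to them lie in
    -- one component `rest`. Any other surviving leaf is charged to its cut core.
    c[G-X]≤ : c[G-_] G X ℕ.≤ suc (length cutCores)
    c[G-X]≤ = subst (λ l → c[G-_] G X ℕ.≤ suc l)
      (List.length-map (component G X ∘ vertex ∘ leaf′) cutCores)
      (c[G-]≤ G X (rest ∷ map (component G X ∘ vertex ∘ leaf′) cutCores) λ u u∉ →
        subst (λ v → component G X v ∈ _) (vertex-kind u)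
          (covered (kind u) (subst (Subset._∉ X) (sym (vertex-kind u)) u∉)))
      where
      leaf′ : Fin m → Kind
      leaf′ = inj₂ ∘ inj₂
      some? = Fin.any? (λ i → ¬? (cut? i))
      -- If every core is cut, only leaves are left and any value will do.
      restOf : Dec (∃[ i ] vertex (core i) Subset.∉ X) → Subset n
      restOf (yes (i , _)) = component G X (vertex (core i))
      restOf (no  _)       = X
      rest = restOf some?
      core-rest : ∀ i → vertex (core i) Subset.∉ X → component G X (vertex (core i)) ≡ rest
      core-rest i i∉ with some?
      ... | yes (j , j∉) = component-cong G X (near⇒star (core i) (core j) (λ r → i∉ , j∉ , r) tt)
      ... | no  none     = contradiction (i , i∉) none
      covered : ∀ k → vertex k Subset.∉ X →
                component G X (vertex k) ∈ rest ∷ map (component G X ∘ vertex ∘ leaf′) cutCores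
      covered (hub i)  i∉ = contradiction (hubs⊆ i) i∉
      covered (core i) i∉ = here (core-rest i i∉)
      covered (leaf i) i∉ with cut? i
      ... | yes cut = there (∈-map⁺ (component G X ∘ vertex ∘ leaf′) (∈-filter⁺ cut? (∈-allFin i) cut))
      ... | no ¬cut = here (trans
        (component-cong G X (near⇒star (leaf i) (core i) (λ r → i∉ , ¬cut , r) refl))
        (core-rest i ¬cut))

    ∣X∣≥ : s ℕ.+ length cutCores ℕ.≤ ∣ X ∣
    ∣X∣≥ = subst (ℕ._≤ ∣ X ∣) len
      (unique⇒length≤∣∣ (Unique.map⁺ vertex-injective uniq) (All.map⁺ (All.++⁺ hubs∈ cores∈)))
      where
      ks : List Kind
      ks = map hub (allFin s) ++ map (inj₂ ∘ inj₁) cutCores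
      len : length (map vertex ks) ≡ s ℕ.+ length cutCores
      len = trans (List.length-map vertex ks) (trans (List.length-++ (map hub (allFin s)))
        (cong₂ ℕ._+_ (trans (List.length-map hub (allFin s)) (List.length-tabulate id))
          (List.length-map (inj₂ ∘ inj₁) cutCores)))
      disjoint : ∀ {k} → ¬ (k ∈ map hub (allFin s) × k ∈ map (inj₂ ∘ inj₁) cutCores)
      disjoint (k∈ , k∈′) with ∈-map⁻ hub k∈ | ∈-map⁻ (inj₂ ∘ inj₁) k∈′
      ... | _ , _ , refl | _ , _ , ()
      uniq : Unique ks
      uniq = Unique.++⁺ (Unique.map⁺ Sum.inj₁-injective (Unique.allFin⁺ s))
        (Unique.map⁺ (Sum.inj₁-injective ∘ Sum.inj₂-injective)
          (Unique.filter⁺ cut? (Unique.allFin⁺ m)))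
        disjoint
      hubs∈ : All (λ k → vertex k Subset.∈ X) (map hub (allFin s))
      hubs∈ = All.map⁺ (All.tabulate λ {i} _ → hubs⊆ i)
      cores∈ : All (λ k → vertex k Subset.∈ X) (map (inj₂ ∘ inj₁) cutCores)
      cores∈ = All.map⁺ (All.all-filter cut? (allFin m))

-- Toughness of the hub–core–leaf graph

-- `ℚ._/_` reduces to lowest terms and does not compute on variables. Unnormalised rationals compare
-- by cross-multiplication.
/-mono-≤ : ∀ a c b d .{{_ : NonZero c}} .{{_ : NonZero d}} →
           a ℕ.* d ℕ.≤ b ℕ.* c → + a ℚ./ c ℚ.≤ + b ℚ./ d
/-mono-≤ a (suc c) b (suc d) ad≤bc = ℚ.toℚᵘ-cancel-≤
  (ℚᵘ.≤-respˡ-≃ (ℚᵘ.≃-sym (ℚ.toℚᵘ-fromℚᵘ (mkℚᵘ (+ a) c)))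
  (ℚᵘ.≤-respʳ-≃ (ℚᵘ.≃-sym (ℚ.toℚᵘ-fromℚᵘ (mkℚᵘ (+ b) d)))
    (ℚᵘ.*≤* (subst₂ ℤ._≤_ (ℤ.pos-* a (suc d)) (ℤ.pos-* b (suc c)) (+≤+ ad≤bc)))))

/≤/+/ : ∀ a b c d e f .{{_ : NonZero b}} .{{_ : NonZero d}} .{{_ : NonZero f}} →
        a ℕ.* (d ℕ.* f) ℕ.≤ (c ℕ.* f ℕ.+ e ℕ.* d) ℕ.* b → + a ℚ./ b ℚ.≤ + c ℚ./ d ℚ.+ + e ℚ./ f
/≤/+/ a (suc b) c (suc d) e (suc f) h = ℚ.toℚᵘ-cancel-≤
  (ℚᵘ.≤-respˡ-≃ (ℚᵘ.≃-sym (ℚ.toℚᵘ-fromℚᵘ (mkℚᵘ (+ a) b)))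
  (ℚᵘ.≤-respʳ-≃ (ℚᵘ.≃-sym (ℚᵘ.≃-trans (ℚ.toℚᵘ-homo-+ (+ c ℚ./ suc d) (+ e ℚ./ suc f))
      (ℚᵘ.+-cong (ℚ.toℚᵘ-fromℚᵘ (mkℚᵘ (+ c) d)) (ℚ.toℚᵘ-fromℚᵘ (mkℚᵘ (+ e) f)))))
    (ℚᵘ.*≤* (subst₂ ℤ._≤_ (ℤ.pos-* a (suc d ℕ.* suc f)) eq (+≤+ h)))))
  where
  eq : + ((c ℕ.* suc f ℕ.+ e ℕ.* suc d) ℕ.* suc b) ≡
       (+ c ℤ.* + suc f ℤ.+ + e ℤ.* + suc d) ℤ.* + suc b
  eq = trans (ℤ.pos-* (c ℕ.* suc f ℕ.+ e ℕ.* suc d) (suc b))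
    (cong (ℤ._* + suc b) (cong₂ ℤ._+_ (ℤ.pos-* c (suc f)) (ℤ.pos-* e (suc d))))

infix 4 _≤⁺_
-- Vacuous at `⊤⁺`, so sets that do not disconnect impose no condition.
_≤⁺_ : ℚ → ℚ ⁺ → Set
q ≤⁺ x = ∀ r → x ≡ [ r ] → q ℚ.≤ r

≤⁺-foldr : ∀ {q xs} → All (q ≤⁺_) xs → q ≤⁺ foldr _⊓⁺_ ⊤⁺ xs
≤⁺-foldr {q} (_∷_ {x} {xs} p ps) = ⊓-glb x (foldr _⊓⁺_ ⊤⁺ xs) p (≤⁺-foldr ps)
  where
  ⊓-glb : ∀ x y → q ≤⁺ x → q ≤⁺ y → q ≤⁺ x ⊓⁺ y
  ⊓-glb ⊤⁺    y     p q _ refl = q _ refl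
  ⊓-glb [ _ ] ⊤⁺    p q _ refl = p _ refl
  ⊓-glb [ _ ] [ _ ] p q _ refl = ℚ.⊓-glb (p _ refl) (q _ refl)

<⁺-constℝ : ∀ x {q} y → x <ᴿ constℝ q → q ≤⁺ y → _<⁺_ _<ᴿ_ [ x ] (Maybe.map constℝ y)
<⁺-constℝ x ⊤⁺    _                    _  = [ x ]<⊤⁺
<⁺-constℝ x [ r ] (δ , 0<δ , N , below) q≤ =
  [ (δ , 0<δ , N , λ n ≤n → ℚ.≤-trans (below n ≤n) (q≤ r refl)) ]

module _ (t : ℕ) where
  open HubCoreLeaf (suc t) (2 ℕ.* suc t ℕ.+ 3)

  -- This is `(s + m) / (m + 1)` at `s = t + 1` and `m = 2 * t + 5`.
  ratio : ℚ
  ratio = + (3 ℕ.* t ℕ.+ 6) ℚ./ (6 ℕ.+ 2 ℕ.* t)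

  cutRatio-bound : ∀ X → ratio ≤⁺ cutRatio G X
  cutRatio-bound X r eq with 1 ℕ.<? c[G-_] G X | eq
  ... | yes 1<c | refl =
    /-mono-≤ (3 ℕ.* t ℕ.+ 6) (6 ℕ.+ 2 ℕ.* t) ∣ X ∣ c {{_}} {{ℕ.>-nonZero (ℕ.<⇒≤ 1<c)}} (begin
      -- One hub pays for the component `rest`, so `∣ X ∣` is at least `t + c`. The quotient
      -- `(t + c) / c` does not increase with `c`, and `c` is at most `m + 1 = 6 + 2 * t`.
      (3 ℕ.* t ℕ.+ 6) ℕ.* c              ≡⟨ eq₁ t c ⟩
      t ℕ.* c ℕ.+ c ℕ.* (6 ℕ.+ 2 ℕ.* t)  ≤⟨ ℕ.+-monoˡ-≤ (c ℕ.* (6 ℕ.+ 2 ℕ.* t)) (ℕ.*-monoʳ-≤ t c≤) ⟩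
      t ℕ.* (6 ℕ.+ 2 ℕ.* t) ℕ.+ c ℕ.* (6 ℕ.+ 2 ℕ.* t) ≡⟨ ℕ.*-distribʳ-+ (6 ℕ.+ 2 ℕ.* t) t c ⟨
      (t ℕ.+ c) ℕ.* (6 ℕ.+ 2 ℕ.* t)      ≤⟨ ℕ.*-monoˡ-≤ (6 ℕ.+ 2 ℕ.* t) t+c≤ ⟩
      ∣ X ∣ ℕ.* (6 ℕ.+ 2 ℕ.* t)          ∎)
    where
    open ℕ.≤-Reasoning
    c = c[G-_] G X
    k = length (cutCores X 1<c)
    eq₁ : ∀ t c → (3 ℕ.* t ℕ.+ 6) ℕ.* c ≡ t ℕ.* c ℕ.+ c ℕ.* (6 ℕ.+ 2 ℕ.* t)
    eq₁ = solve-∀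
    eq₂ : ∀ t → suc (2 ℕ.* suc t ℕ.+ 3) ≡ 6 ℕ.+ 2 ℕ.* t
    eq₂ = solve-∀
    c≤ : c ℕ.≤ 6 ℕ.+ 2 ℕ.* t
    c≤ = begin
      c                          ≤⟨ c[G-X]≤ X 1<c ⟩
      suc k                      ≤⟨ ℕ.s≤s (List.length-filter (cut? X 1<c) (allFin _)) ⟩
      suc (length (allFin (2 ℕ.* suc t ℕ.+ 3)))
        ≡⟨ cong suc (List.length-tabulate {n = 2 ℕ.* suc t ℕ.+ 3} id) ⟩
      suc (2 ℕ.* suc t ℕ.+ 3)    ≡⟨ eq₂ t ⟩
      6 ℕ.+ 2 ℕ.* t              ∎
    t+c≤ : t ℕ.+ c ℕ.≤ ∣ X ∣
    t+c≤ = begin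
      t ℕ.+ c     ≤⟨ ℕ.+-monoʳ-≤ t (c[G-X]≤ X 1<c) ⟩
      t ℕ.+ suc k ≡⟨ ℕ.+-suc t k ⟩
      suc t ℕ.+ k ≤⟨ ∣X∣≥ X 1<c ⟩
      ∣ X ∣       ∎

  τ-bound : ∀ x → x <ᴿ constℝ ratio → _<⁺_ _<ᴿ_ [ x ] (τ G)
  τ-bound x x< = <⁺-constℝ x _ x<
    (≤⁺-foldr {xs = map (cutRatio G) (subsets n)} (All.map⁺ (All.tabulate λ {X} _ → cutRatio-bound X)))

  -- The defect `3/2 - ratio` is `3 / (6 + 2 * t)`, here `3 / (4 * d + 10)`. The term
  -- `2 * (suc d + 6)` is the slack after cross-multiplication.
  3/2≤ratio+ : ∀ d → t ≡ 2 ℕ.* suc d → + 3 ℚ./ 2 ℚ.≤ ratio ℚ.+ + 1 ℚ./ suc d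
  3/2≤ratio+ d refl = /≤/+/ 3 2 (3 ℕ.* t ℕ.+ 6) (6 ℕ.+ 2 ℕ.* t) 1 (suc d)
    (subst₂ ℕ._≤_ refl (sym (eq d)) (ℕ.m≤m+n _ (2 ℕ.* (suc d ℕ.+ 6))))
    where
    eq : ∀ d → ((3 ℕ.* (2 ℕ.* suc d) ℕ.+ 6) ℕ.* suc d ℕ.+ 1 ℕ.* (6 ℕ.+ 2 ℕ.* (2 ℕ.* suc d))) ℕ.* 2 ≡
               3 ℕ.* ((6 ℕ.+ 2 ℕ.* (2 ℕ.* suc d)) ℕ.* suc d) ℕ.+ 2 ℕ.* (suc d ℕ.+ 6)
    eq = solve-∀

-- Approaching 3/2

1/suc≤ : ∀ δ → 0ℚ ℚ.< δ → ∃[ d ] + 1 ℚ./ suc d ℚ.≤ δ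
1/suc≤ (ℚ.mkℚ (+ zero)   d _) (ℚ.*<* (ℤ.+<+ ()))
1/suc≤ (ℚ.mkℚ -[1+ a ]   d _) (ℚ.*<* ())
1/suc≤ (ℚ.mkℚ (+ suc a)  d _) _ = d , ℚ.toℚᵘ-cancel-≤
  (ℚᵘ.≤-respˡ-≃ (ℚᵘ.≃-sym (ℚ.toℚᵘ-fromℚᵘ (mkℚᵘ (+ 1) d)))
    (ℚᵘ.*≤* (+≤+ (ℕ.*-monoˡ-≤ (suc d) (ℕ.s≤s (ℕ.z≤n {a}))))))

-- `δ` is an eventual lower bound for `ε`. Half of it absorbs the defect `1 / suc d`, and the other
-- half witnesses the strict inequality.
ratio→3/2 : ∀ ε → 0ℝ <ᴿ ε → ∃[ t ] (3/2ℝ -ᴿ ε <ᴿ constℝ (ratio t))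
ratio→3/2 ε 0<ε@(δ , 0<δ , N , _) = t , ½ ℚ.* δ , 0<½δ , N , λ n ≤n →
  bound (ratio t) (+ 3 ℚ./ 2) (+ 1 ℚ./ suc d) (seq ε n) (proj₂ small) (3/2≤ratio+ t d refl)
    (eventually-≥ ε 0<ε n ≤n)
  where
  0<½δ : 0ℚ ℚ.< ½ ℚ.* δ
  0<½δ = *-pos (ℚ.positive⁻¹ ½) 0<δ
  small = 1/suc≤ (½ ℚ.* δ) 0<½δ
  d = proj₁ small
  t = 2 ℕ.* suc d
  bound : ∀ q h e x → e ℚ.≤ ½ ℚ.* δ → h ℚ.≤ q ℚ.+ e → δ ℚ.≤ x → h ℚ.- x ℚ.+ ½ ℚ.* δ ℚ.≤ q
  bound q h e x e≤ h≤ δ≤x = begin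
    h ℚ.- x ℚ.+ ½ ℚ.* δ
      ≤⟨ ℚ.+-monoˡ-≤ (½ ℚ.* δ)
           (ℚ.+-mono-≤ (ℚ.≤-trans h≤ (ℚ.+-monoʳ-≤ q e≤)) (ℚ.neg-antimono-≤ δ≤x)) ⟩
    q ℚ.+ ½ ℚ.* δ ℚ.- δ ℚ.+ ½ ℚ.* δ
      ≡⟨ solve 2 (λ q δ → q :+ con ½ :* δ :- δ :+ con ½ :* δ := q) refl q δ ⟩
    q ∎
    where
    open ℚ.≤-Reasoning
    open +-*-Solver

construction : ∀ t ε → 3/2ℝ -ᴿ ε <ᴿ constℝ (ratio t) →
  Σ[ G ∈ Graph ] Σ[ conn ∈ Connected G ]
    (¬ ResistanceNonnegative G conn × _<⁺_ _<ᴿ_ [ 3/2ℝ -ᴿ ε ] (τ G))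
construction t ε below =
  -- Taking `s = suc t` supplies the hub `zero`, through which all vertices are connected.
  G , connected zero , ¬RN (connected zero) refl , τ-bound t (3/2ℝ -ᴿ ε) below
  where open HubCoreLeaf (suc t) (2 ℕ.* suc t ℕ.+ 3)

theorem6 : (ε : ℝ) → 0ℝ <ᴿ ε →
    Σ[ G ∈ Graph ] Σ[ conn ∈ Connected G ]
    (¬ ResistanceNonnegative G conn × _<⁺_ _<ᴿ_ [ 3/2ℝ -ᴿ ε ] (τ G))
theorem6 ε 0<ε = construction (proj₁ (ratio→3/2 ε 0<ε)) ε (proj₂ (ratio→3/2 ε 0<ε))
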